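{- As formal power series in $q$ (equivalently, for complex $q$ with $|q|<1$), $$\sum_{n\ge 0}\frac{q^{2n^2}}{(q;q)_{2n}}=\frac{1}{(q;q)_\infty}\sum_{k\in\mathbb{Z}}\left(q^{12k^2+k}-q^{12k^2+7k+1}\right).$$
   Context: $(q;q)_n=\prod_{j=1}^{n}(1-q^j)$ and $(q;q)_\infty=\prod_{j\ge1}(1-q^j)$. -}

module Defs where

open import Data.Bool.Base using (if_then_else_)
open import Data.Empty using (⊥; ⊥-elim)
open import Data.Fin.Base using (Fin; zero; suc; toℕ)
import Data.Fin.Properties as Fin
open import Data.Integer.Base as ℤ
  using (ℤ; +_; -[1+_]; ∣_∣; 0ℤ; 1ℤ; _+_; _-_; _*_; _^_)
import Data.Integer.Properties as ℤ
open import Data.Integer.Tactic.RingSolver using (solve-∀)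
open import Data.List.Base using (List; foldr; map; upTo; _++_)
open import Data.List.Membership.Propositional using (_∈_; _∉_)
open import Data.List.Membership.Propositional.Properties
  using (∈-map⁺; ∈-map⁻; ∈-++⁺ˡ; ∈-++⁺ʳ; ∈-upTo⁺)
open import Data.List.Relation.Unary.Unique.Propositional using (Unique)
import Data.List.Relation.Unary.Unique.Propositional.Properties as Unique
open import Data.Nat.Base as ℕ using (ℕ; zero; suc; _≤_; _<_; _∸_; z≤n; s≤s)
import Data.Nat.Properties as ℕ
open import Data.Product.Base using (∃; _×_; _,_; proj₁)
open import Function.Base using (_∘_)
open import Relation.Binary.PropositionalEquality
open import Relation.Nullary.Decidable using (⌊_⌋; yes; no)

open import Algebra.Properties.Semiring.Sum ℤ.+-*-semiring
  using (sum-cong-≗; sum-replicate-zero; ∑-distrib-+; sum⁺-syntax)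

-- n ↦ the coefficient of q^n; the equality is _≈_.
PowerSeries : Set
PowerSeries = ℕ → ℤ

infix  4 _≈_
infixl 6 _+ˢ_ _-ˢ_
infixl 7 _*ˢ_ _/ˢ_
infixr 8 q^_

_≈_ : PowerSeries → PowerSeries → Set
A ≈ B = ∀ n → A n ≡ B n

q^_ : ℕ → PowerSeries
(q^ k) n = if ⌊ n ℕ.≟ k ⌋ then 1ℤ else 0ℤ

0ˢ 1ˢ : PowerSeries
0ˢ _ = 0ℤ
1ˢ   = q^ 0

_+ˢ_ _-ˢ_ _*ˢ_ : PowerSeries → PowerSeries → PowerSeries
(A +ˢ B) n = A n + B n
(A -ˢ B) n = A n - B n
(A *ˢ B) n = ∑[ i ≤ n ] (A (toℕ i) * B (n ∸ toℕ i))

-- geometric A n = Σ_{j < n} (1 - A)^j, by Horner's rule.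
geometric : PowerSeries → ℕ → PowerSeries
geometric A zero    = 0ˢ
geometric A (suc n) = 1ˢ +ˢ (1ˢ -ˢ A) *ˢ geometric A n

-- The inverse of a series with constant term 1, as Σ_j (1 - A)^j: the
-- powers with j > m do not contribute to the coefficient of q^m.  It is
-- an inverse by *ˢ-inverseʳ below, and meaningless for other constant
-- terms.
1/ˢ_ : PowerSeries → PowerSeries
(1/ˢ A) m = geometric A (suc m) m

_/ˢ_ : PowerSeries → PowerSeries → PowerSeries
A /ˢ B = A *ˢ (1/ˢ B)

-- A family is summable if each power of q has a nonzero coefficient in
-- only finitely many members (all of them in a duplicate-free list).
Summable : {I : Set} → (I → PowerSeries) → Set
Summable {I} f =
  ∀ m → ∃ λ (is : List I) → Unique is × (∀ i → i ∉ is → f i m ≡ 0ℤ)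

∑ˢ : {I : Set} (f : I → PowerSeries) → Summable f → PowerSeries
∑ˢ f s m = foldr _+_ 0ℤ (map (λ i → f i m) (proj₁ (s m)))

-- Convergence in the q-adic topology: each coefficient is eventually
-- constant.
Convergent : (ℕ → PowerSeries) → Set
Convergent A = ∀ m → ∃ λ N → ∀ n → N ≤ n → A n m ≡ A N m

lim : (A : ℕ → PowerSeries) → Convergent A → PowerSeries
lim A c m = A (proj₁ (c m)) m

*ˢ-cong-≤ : ∀ {A A′ B B′} n → (∀ i → i ≤ n → A i ≡ A′ i) →
            (∀ i → i ≤ n → B i ≡ B′ i) → (A *ˢ B) n ≡ (A′ *ˢ B′) n
*ˢ-cong-≤ n a b = sum-cong-≗ {suc n} λ i →
  cong₂ _*_ (a _ (ℕ.≤-pred (Fin.toℕ<n i))) (b _ (ℕ.m∸n≤m n (toℕ i)))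

*ˢ-vanishes : ∀ {A} B n → (∀ i → i ≤ n → A i ≡ 0ℤ) → (A *ˢ B) n ≡ 0ℤ
*ˢ-vanishes B n a = trans
  (sum-cong-≗ {suc n} λ i → cong (_* B (n ∸ toℕ i)) (a _ (ℕ.≤-pred (Fin.toℕ<n i))))
  (sum-replicate-zero (suc n))

*ˢ-identityˡ : ∀ A → 1ˢ *ˢ A ≈ A
*ˢ-identityˡ A n = trans
  (cong₂ _+_ (ℤ.*-identityˡ (A n)) (sum-replicate-zero n))
  (ℤ.+-identityʳ (A n))

*ˢ-identityʳ : ∀ A → A *ˢ 1ˢ ≈ A
*ˢ-identityʳ A zero    = trans (ℤ.+-identityʳ _) (ℤ.*-identityʳ (A 0))
*ˢ-identityʳ A (suc n) = trans
  (cong₂ _+_ (ℤ.*-zeroʳ (A 0)) (*ˢ-identityʳ (A ∘ suc) n))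
  (ℤ.+-identityˡ _)

*ˢ-distribʳ : ∀ A B C → (A +ˢ B) *ˢ C ≈ A *ˢ C +ˢ B *ˢ C
*ˢ-distribʳ A B C n = trans
  (sum-cong-≗ {suc n} λ i → ℤ.*-distribʳ-+ (C (n ∸ toℕ i)) (A (toℕ i)) (B (toℕ i)))
  (∑-distrib-+ {suc n} (λ i → A (toℕ i) * C (n ∸ toℕ i))
                       (λ i → B (toℕ i) * C (n ∸ toℕ i)))

q^-below : ∀ k n → n < k → (q^ k) n ≡ 0ℤ
q^-below k n n<k with n ℕ.≟ k
... | yes refl = ⊥-elim (ℕ.<-irrefl refl n<k)
... | no  _    = refl

private
  -- If D has no constant term, (D * B)_n depends only on B_j with j < n.
  *ˢ-cong-< : ∀ {D B B′} n → D 0 ≡ 0ℤ → (∀ j → j < n → B j ≡ B′ j) →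
              (D *ˢ B) n ≡ (D *ˢ B′) n
  *ˢ-cong-< {D} {B} {B′} n D₀ b = cong₂ _+_
    (trans (cong (_* B n) D₀) (sym (cong (_* B′ n) D₀)))
    (sum-cong-≗ {n} λ i → cong (D (suc (toℕ i)) *_)
      (b _ (ℕ.∸-monoʳ-< {n} {suc (toℕ i)} {0} (s≤s z≤n) (Fin.toℕ<n i))))

  module _ (A : PowerSeries) (A₀ : A 0 ≡ 1ℤ) where

    D₀ : (1ˢ -ˢ A) 0 ≡ 0ℤ
    D₀ = cong (1ℤ -_) A₀

    stable : ∀ n m → m < n → geometric A (suc n) m ≡ geometric A n m
    stable (suc n) m (s≤s m≤n) = cong (λ x → 1ˢ m + x)
      (*ˢ-cong-< {1ˢ -ˢ A} m D₀ λ j j<m →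
        stable n j (ℕ.<-≤-trans j<m m≤n))

    geometric≡1/ : ∀ n m → m < n → geometric A n m ≡ (1/ˢ A) m
    geometric≡1/ (suc n) m m<1+n with m ℕ.≟ n
    ... | yes refl = refl
    ... | no  m≢n  = trans (stable n m m<n) (geometric≡1/ n m m<n)
      where m<n = ℕ.≤∧≢⇒< (ℕ.≤-pred m<1+n) m≢n

*ˢ-inverseʳ : ∀ A → A 0 ≡ 1ℤ → A *ˢ (1/ˢ A) ≈ 1ˢ
*ˢ-inverseʳ A A₀ m = begin
  a                ≡⟨ lemma₁ a d ⟩
  (a + d) - d      ≡⟨ cong (_- d) a+d≡b ⟩
  (1/ˢ A) m - d    ≡⟨ cong (_- d) b≡1+d ⟩
  (1ˢ m + d) - d   ≡⟨ sym (lemma₁ (1ˢ m) d) ⟩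
  1ˢ m             ∎
  where
  open ≡-Reasoning
  D = 1ˢ -ˢ A
  a = (A *ˢ (1/ˢ A)) m
  d = (D *ˢ (1/ˢ A)) m

  lemma₁ : ∀ x y → x ≡ (x + y) - y
  lemma₁ = solve-∀

  lemma₂ : ∀ x y → x + (y - x) ≡ y
  lemma₂ = solve-∀

  b≡1+d : (1/ˢ A) m ≡ 1ˢ m + d
  b≡1+d = cong (λ x → 1ˢ m + x) (*ˢ-cong-< {D} m (D₀ A A₀) (geometric≡1/ A A₀ m))

  a+d≡b : a + d ≡ (1/ˢ A) m
  a+d≡b = begin
    a + d                       ≡⟨ sym (*ˢ-distribʳ A D (1/ˢ A) m) ⟩
    ((A +ˢ D) *ˢ (1/ˢ A)) m     ≡⟨ *ˢ-cong-≤ {B = 1/ˢ A} m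
                                     (λ i _ → lemma₂ (A i) (1ˢ i)) (λ _ _ → refl) ⟩
    (1ˢ *ˢ (1/ˢ A)) m           ≡⟨ *ˢ-identityˡ (1/ˢ A) m ⟩
    (1/ˢ A) m                   ∎

qPoch : ℕ → PowerSeries
qPoch zero    = 1ˢ
qPoch (suc n) = qPoch n *ˢ (1ˢ -ˢ q^ suc n)

private
  qPoch-suc : ∀ n m → m ≤ n → qPoch (suc n) m ≡ qPoch n m
  qPoch-suc n m m≤n = trans
    (*ˢ-cong-≤ {qPoch n} {B′ = 1ˢ} m (λ _ _ → refl) λ i i≤m →
      trans (cong (1ˢ i -_) (q^-below (suc n) i (s≤s (ℕ.≤-trans i≤m m≤n))))
            (ℤ.+-identityʳ (1ˢ i)))
    (*ˢ-identityʳ (qPoch n) m)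

  qPoch-stable : ∀ m d → qPoch (d ℕ.+ m) m ≡ qPoch m m
  qPoch-stable m zero    = refl
  qPoch-stable m (suc d) =
    trans (qPoch-suc (d ℕ.+ m) m (ℕ.m≤n+m m d)) (qPoch-stable m d)

qPoch-convergent : Convergent qPoch
qPoch-convergent m = m , λ n m≤n →
  subst (λ k → qPoch k m ≡ qPoch m m) (ℕ.m∸n+n≡m m≤n) (qPoch-stable m (n ∸ m))

qPoch∞ : PowerSeries
qPoch∞ = lim qPoch qPoch-convergent

qPoch-constant : ∀ n → qPoch n 0 ≡ 1ℤ
qPoch-constant zero    = refl
qPoch-constant (suc n) = trans (qPoch-suc n 0 z≤n) (qPoch-constant n)

qPoch∞-constant : qPoch∞ 0 ≡ 1ℤ
qPoch∞-constant = refl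

lhs-summable : Summable (λ n → q^ (2 ℕ.* n ℕ.^ 2) /ˢ qPoch (2 ℕ.* n))
lhs-summable m = upTo (suc m) , Unique.upTo⁺ (suc m) , λ n n∉ →
  *ˢ-vanishes (1/ˢ qPoch (2 ℕ.* n)) m λ i i≤m → q^-below _ i
    (ℕ.≤-<-trans i≤m
      (ℕ.<-≤-trans (ℕ.≰⇒> (λ n≤m → n∉ (∈-upTo⁺ (s≤s n≤m)))) (n≤2n² n)))
  where
  n≤2n² : ∀ n → n ≤ 2 ℕ.* n ℕ.^ 2
  n≤2n² zero      = z≤n
  n≤2n² n@(suc _) = ℕ.≤-trans (ℕ.m≤m*n n (n ℕ.^ 1) ⦃ ℕ.m^n≢0 n 1 ⦄)
                              (ℕ.m≤n*m (n ℕ.^ 2) 2)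

private
  pos-quadratic : ∀ a b c n →
    + (a ℕ.+ b ℕ.* n ℕ.+ c ℕ.* (n ℕ.* n)) ≡ + a + + b * + n + + c * (+ n * + n)
  pos-quadratic a b c n = cong₂ (λ x y → + a + x + y) (ℤ.pos-* b n)
    (trans (ℤ.pos-* c (n ℕ.* n)) (cong (λ x → + c * x) (ℤ.pos-* n n)))

  ≤-by : ∀ a b c n {x e} → e ≡ x + (+ a + + b * + n + + c * (+ n * + n)) → x ℤ.≤ e
  ≤-by a b c n {x} e≡ = ℤ.≤-trans
    (ℤ.i≤i+j x (+ (a ℕ.+ b ℕ.* n ℕ.+ c ℕ.* (n ℕ.* n))))
    (ℤ.≤-reflexive (trans (cong (λ y → x + y) (pos-quadratic a b c n)) (sym e≡)))

  e₁⁺ : ∀ x → + 12 * (x * (x * 1ℤ)) + x ≡ x + (+ 0 + + 0 * x + + 12 * (x * x))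
  e₁⁺ = solve-∀

  e₁⁻ : ∀ x → + 12 * (ℤ.- (1ℤ + x) * (ℤ.- (1ℤ + x) * 1ℤ)) + ℤ.- (1ℤ + x)
            ≡ (1ℤ + x) + (+ 10 + + 22 * x + + 12 * (x * x))
  e₁⁻ = solve-∀

  e₂⁺ : ∀ x → + 12 * (x * (x * 1ℤ)) + + 7 * x + + 1
            ≡ x + (+ 1 + + 6 * x + + 12 * (x * x))
  e₂⁺ = solve-∀

  e₂⁻ : ∀ x → + 12 * (ℤ.- (1ℤ + x) * (ℤ.- (1ℤ + x) * 1ℤ)) + + 7 * ℤ.- (1ℤ + x) + + 1
            ≡ (1ℤ + x) + (+ 5 + + 16 * x + + 12 * (x * x))
  e₂⁻ = solve-∀

  bound₁ : ∀ k n → k ≡ ℤ.- (1ℤ + + n) → 1ℤ + + n ℤ.≤ + 12 * k ^ 2 + k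
  bound₁ k n k≡ = ≤-by 10 22 12 n
    (trans (cong (λ j → + 12 * (j * (j * 1ℤ)) + j) k≡) (e₁⁻ (+ n)))

  bound₂ : ∀ k n → k ≡ ℤ.- (1ℤ + + n) → 1ℤ + + n ℤ.≤ + 12 * k ^ 2 + + 7 * k + + 1
  bound₂ k n k≡ = ≤-by 5 16 12 n
    (trans (cong (λ j → + 12 * (j * (j * 1ℤ)) + + 7 * j + + 1) k≡) (e₂⁻ (+ n)))

-- In particular these exponents are nonnegative, so that passing to ∣_∣
-- in order to use q^_ does not change them.
∣k∣≤12k²+k : ∀ k → + ∣ k ∣ ℤ.≤ + 12 * k ^ 2 + k
∣k∣≤12k²+k (+ n)    = ≤-by 0 0 12 n (e₁⁺ (+ n))
∣k∣≤12k²+k -[1+ n ] = bound₁ -[1+ n ] n refl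

∣k∣≤12k²+7k+1 : ∀ k → + ∣ k ∣ ℤ.≤ + 12 * k ^ 2 + + 7 * k + + 1
∣k∣≤12k²+7k+1 (+ n)    = ≤-by 1 6 12 n (e₂⁺ (+ n))
∣k∣≤12k²+7k+1 -[1+ n ] = bound₂ -[1+ n ] n refl

private
  ∣k∣≤∣e∣ : ∀ {k e} → + ∣ k ∣ ℤ.≤ e → ∣ k ∣ ≤ ∣ e ∣
  ∣k∣≤∣e∣ (ℤ.+≤+ k≤e) = k≤e

  interval : ℕ → List ℤ
  interval m = map +_ (upTo (suc m)) ++ map -[1+_] (upTo m)

  interval-unique : ∀ m → Unique (interval m)
  interval-unique m = Unique.++⁺
    (Unique.map⁺ ℤ.+-injective (Unique.upTo⁺ (suc m)))
    (Unique.map⁺ ℤ.-[1+-injective (Unique.upTo⁺ m))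
    λ { (p , n) → disjoint (∈-map⁻ +_ p) (∈-map⁻ -[1+_] n) }
    where
    disjoint : ∀ {k} {xs ys : List ℕ} → (∃ λ a → a ∈ xs × k ≡ + a) →
               (∃ λ b → b ∈ ys × k ≡ -[1+ b ]) → ⊥
    disjoint (_ , _ , refl) (_ , _ , ())

  ∈-interval : ∀ m k → ∣ k ∣ ≤ m → k ∈ interval m
  ∈-interval m (+ n)    n≤m = ∈-++⁺ˡ (∈-map⁺ +_ (∈-upTo⁺ (s≤s n≤m)))
  ∈-interval m -[1+ n ] n<m =
    ∈-++⁺ʳ (map +_ (upTo (suc m))) (∈-map⁺ -[1+_] (∈-upTo⁺ n<m))

rhs-summable : Summable (λ k → q^ ∣ + 12 * k ^ 2 + k ∣
                            -ˢ q^ ∣ + 12 * k ^ 2 + + 7 * k + + 1 ∣)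
rhs-summable m = interval m , interval-unique m , λ k k∉ →
  let m<∣k∣ = ℕ.≰⇒> (k∉ ∘ ∈-interval m k) in
  cong₂ _-_
    (q^-below _ m (ℕ.<-≤-trans m<∣k∣ (∣k∣≤∣e∣ {k} (∣k∣≤12k²+k k))))
    (q^-below _ m (ℕ.<-≤-trans m<∣k∣ (∣k∣≤∣e∣ {k} (∣k∣≤12k²+7k+1 k))))

{-# OPTIONS --safe #-}

-- Put q = t².  Euler's expansion Σ_m (-1)^m t^{m²}/(t²;t²)_m = (t;t²)_∞, multiplied
-- by (t²;t²)_∞, gives
--
--   (q;q)_∞ Σ_m (-1)^m t^{m²}/(q;q)_m = (t;t)_∞ = Σ_k (-1)^k t^{k(3k+1)/2}
--
-- by the pentagonal number theorem, and the corollary is the part of this identity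
-- that is even in t: on the left m = 2n remains, on the right k = 4j and k = 4j + 1,
-- which contribute q^{12j²+j} and -q^{12j²+7j+1}.  Both classical identities are proved modulo a
-- power of t, Euler's from f_k = (1 - t^{2k+1}) f_{k+1} for
-- f_k = Σ_m (-1)^m t^{m²+2km}/(q;q)_m, the pentagonal number theorem by Shanks'
-- telescoping of Σ_{s≤n} (-1)^s (t;t)_n/(t;t)_s t^{sn+s(s+1)/2}.
module Submission where

open import Defs
open import Data.Integer.Base using (+_; ∣_∣; _+_; _*_; _^_)
import Data.Nat.Base as ℕ

open import Algebra.Bundles using (CommutativeRing)
import Algebra.Solver.Ring
open import Algebra.Solver.Ring.AlmostCommutativeRing
  using (fromCommutativeRing; _-Raw-AlmostCommutative⟶_)
open import Data.Bool.Base using (if_then_else_)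
open import Data.Integer.Base as ℤ using (ℤ; -[1+_]; 0ℤ; 1ℤ; -1ℤ; _-_)
import Data.Integer.Properties as ℤ
open import Data.Integer.Tactic.RingSolver using (solve-∀)
open import Data.List.Base using ([]; _∷_; foldr; map; upTo; _++_)
import Data.List.Properties as List
open import Data.List.Membership.Propositional.Properties using (∈-upTo⁻)
import Data.Maybe.Base as Maybe
open import Data.Nat.Base using (ℕ; zero; suc; _≤_; _<_; z≤n; s≤s)
import Data.Nat.Properties as ℕ
import Data.Nat.Tactic.RingSolver as ℕ
open import Data.Product.Base using (_,_; proj₂)
open import Function.Base using (_∘_)
open import Level using (0ℓ)
import Relation.Binary.Reasoning.Setoid
open import Relation.Binary.PropositionalEquality
  using (_≡_; refl; sym; trans; cong; cong₂; module ≡-Reasoning)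
open import Relation.Nullary.Decidable using (dec⇒maybe; isYes≗does)

-- Doubling, finite sums and pentagonal exponents.

double : ℕ → ℕ
double zero    = zero
double (suc n) = suc (suc (double n))

-- The bridge between `double`, whose two constructors per step let `sgn`, `dilate` and `even`
-- compute along it, and the sums that the solver handles.
double≡+ : ∀ n → double n ≡ n ℕ.+ n
double≡+ zero    = refl
double≡+ (suc n) = cong suc (trans (cong suc (double≡+ n)) (sym (ℕ.+-suc n n)))

double-mono-≤ : ∀ {m n} → m ≤ n → double m ≤ double n
double-mono-≤ z≤n     = z≤n
double-mono-≤ (s≤s p) = s≤s (s≤s (double-mono-≤ p))

-- Parametrised by the operation and its unit alone, so that sums of power series are the same terms
-- whether or not one works modulo some q^N.
module Sum {A : Set} (_⊕_ : A → A → A) (ε : A) where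

  ∑< : ℕ → (ℕ → A) → A
  ∑< zero    f = ε
  ∑< (suc n) f = ∑< n f ⊕ f n

T : ℕ → ℕ
T zero    = 0
T (suc n) = suc n ℕ.+ T n

-- p⁺ n = n(3n + 1)/2 and p⁻ n = n(3n - 1)/2
p⁺ p⁻ : ℕ → ℕ
p⁺ n = n ℕ.* n ℕ.+ T n
p⁻ zero    = 0
p⁻ (suc n) = suc n ℕ.+ n ℕ.+ p⁺ n

-- The two classical identities modulo a power of the variable.

module Identities (R : CommutativeRing 0ℓ 0ℓ) where

  open CommutativeRing R hiding (zero)
    renaming (_≈_ to _≋_; _+_ to _⊕_; _*_ to _⊗_; _-_ to _⊖_; -_ to ⊖_;
              refl to ≋-refl; sym to ≋-sym; trans to ≋-trans)

  -- `x^_` gives the powers of t, and `x^-vanishes` puts the calculation modulo t^N. `ℤ⟶R` supplies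
  -- the solver with integer coefficients.
  module Powers
    (ℤ⟶R : CommutativeRing.rawRing ℤ.+-*-commutativeRing
             -Raw-AlmostCommutative⟶ fromCommutativeRing R)
    (x^_ : ℕ → Carrier)
    (x^0 : x^ 0 ≋ 1#)
    (x^-+ : ∀ a b → x^ (a ℕ.+ b) ≋ x^ a ⊗ x^ b)
    (N : ℕ)
    (x^-vanishes : ∀ {k} → N ≤ k → x^ k ≋ 0#)
    where

    open Sum _⊕_ 0# public
    open import Relation.Binary.Reasoning.Setoid setoid

    module Solver = Algebra.Solver.Ring _ _ ℤ⟶R
      (λ a b → Maybe.map (reflexive ∘ cong (_-Raw-AlmostCommutative⟶_.⟦_⟧ ℤ⟶R)) (dec⇒maybe (a ℤ.≟ b)))
    open Solver using (solve; _:=_; _:+_; _:*_; _:-_; :-_)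

    private
      ⊖-cong : ∀ {a b c d} → a ≋ b → c ≋ d → a ⊖ c ≋ b ⊖ d
      ⊖-cong p q = +-cong p (-‿cong q)

      x^-cong : ∀ {a b} → a ≡ b → x^ a ≋ x^ b
      x^-cong e = reflexive (cong x^_ e)

      ⊗-vanishes : ∀ {a b} → b ≋ 0# → a ⊗ b ≋ 0#
      ⊗-vanishes p = ≋-trans (*-congˡ p) (zeroʳ _)

      ⊕-vanishes : ∀ {a b} → b ≋ 0# → a ⊕ b ≋ a
      ⊕-vanishes p = ≋-trans (+-congˡ p) (+-identityʳ _)

      ∑<-head : ∀ f n → (∀ j → f (suc j) ≋ 0#) → ∑< (suc n) f ≋ f 0
      ∑<-head f zero    v = +-identityˡ _
      ∑<-head f (suc n) v = ≋-trans (⊕-vanishes (v n)) (∑<-head f n v)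

    [1-a]b : ∀ a b → (1# ⊖ a) ⊗ b ≋ b ⊖ a ⊗ b
    [1-a]b a b = ≋-trans (lemma 1# a b) (⊖-cong (*-identityˡ b) ≋-refl)
      where
      -- The unit enters the solver as a variable `o`: the solver's own constant 1 is the image of
      -- an integer and agrees with `1#` only up to `≋`.
      lemma : ∀ o a b → (o ⊖ a) ⊗ b ≋ o ⊗ b ⊖ a ⊗ b
      lemma = solve 3 (λ o a b → (o :- a) :* b := o :* b :- a :* b) ≋-refl

    divide : ∀ {a b c d} → a ⊗ b ≋ 1# → a ⊗ c ≋ d → c ≋ b ⊗ d
    divide {a} {b} {c} {d} ab≋1 ac≋d = begin
      c              ≈⟨ *-identityˡ c ⟨
      1# ⊗ c         ≈⟨ *-congʳ ab≋1 ⟨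
      a ⊗ b ⊗ c      ≈⟨ *-congʳ (*-comm a b) ⟩
      b ⊗ a ⊗ c      ≈⟨ *-assoc b a c ⟩
      b ⊗ (a ⊗ c)    ≈⟨ *-congˡ ac≋d ⟩
      b ⊗ d          ∎

    -- Signs and partial pentagonal sums.

    sgn : ℕ → Carrier
    sgn zero    = 1#
    sgn (suc n) = ⊖ sgn n

    private
      ⊖⊖-cancel : ∀ a → ⊖ (⊖ a) ≋ a
      ⊖⊖-cancel = solve 1 (λ a → :- (:- a) := a) ≋-refl

    sgn-double : ∀ n → sgn (double n) ≋ 1#
    sgn-double zero    = ≋-refl
    sgn-double (suc n) = ≋-trans (⊖⊖-cancel (sgn (double n))) (sgn-double n)

    -- The part |k| ≤ n of Σ_k (-1)^k x^{k(3k+1)/2}; the indices -n and n contribute the exponents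
    -- `p⁻ n` and `p⁺ n`.
    pentagonal : ℕ → Carrier
    pentagonal zero    = 1#
    pentagonal (suc n) = pentagonal n ⊕ sgn (suc n) ⊗ (x^ p⁻ (suc n) ⊕ x^ p⁺ (suc n))

    -- The terms n + 1, …, n + 4 of the sum, with their signs for n divisible by 4.
    pentagonalBlock : ℕ → Carrier
    pentagonalBlock n = t 2 ⊕ t 4 ⊖ t 1 ⊖ t 3
      where
      t : ℕ → Carrier
      t i = x^ p⁻ (i ℕ.+ n) ⊕ x^ p⁺ (i ℕ.+ n)

    -- Blocks have length four because the parity of k(3k+1)/2 has period four in k, so `even` will
    -- keep the same positions of every block.
    pentagonal-blocks : ∀ r → pentagonal (double (double r)) ≋
                        1# ⊕ ∑< r (λ j → pentagonalBlock (double (double j)))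
    pentagonal-blocks zero    = ≋-sym (+-identityʳ 1#)
    pentagonal-blocks (suc r) = begin
      pentagonal n ⊕ ⊖ σ ⊗ t 1 ⊕ ⊖ (⊖ σ) ⊗ t 2 ⊕ ⊖ (⊖ (⊖ σ)) ⊗ t 3 ⊕ ⊖ (⊖ (⊖ (⊖ σ))) ⊗ t 4
        ≈⟨ lemma (pentagonal n) σ (t 1) (t 2) (t 3) (t 4) ⟩
      pentagonal n ⊕ σ ⊗ (t 2 ⊕ t 4 ⊖ t 1 ⊖ t 3)
        ≈⟨ +-cong (pentagonal-blocks r) (≋-trans (*-congʳ (sgn-double (double r))) (*-identityˡ _)) ⟩
      1# ⊕ ∑< r (λ j → pentagonalBlock (double (double j))) ⊕ pentagonalBlock n
        ≈⟨ +-assoc _ _ _ ⟩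
      1# ⊕ ∑< (suc r) (λ j → pentagonalBlock (double (double j))) ∎
      where
      n = double (double r)
      σ = sgn n
      t : ℕ → Carrier
      t i = x^ p⁻ (i ℕ.+ n) ⊕ x^ p⁺ (i ℕ.+ n)
      lemma : ∀ a σ t₁ t₂ t₃ t₄ →
        a ⊕ ⊖ σ ⊗ t₁ ⊕ ⊖ (⊖ σ) ⊗ t₂ ⊕ ⊖ (⊖ (⊖ σ)) ⊗ t₃ ⊕ ⊖ (⊖ (⊖ (⊖ σ))) ⊗ t₄
        ≋ a ⊕ σ ⊗ (t₂ ⊕ t₄ ⊖ t₁ ⊖ t₃)
      lemma = solve 6 (λ a σ t₁ t₂ t₃ t₄ →
        a :+ (:- σ) :* t₁ :+ (:- (:- σ)) :* t₂ :+ (:- (:- (:- σ))) :* t₃ :+ (:- (:- (:- (:- σ)))) :* t₄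
        := a :+ σ :* (t₂ :+ t₄ :- t₁ :- t₃)) ≋-refl

    -- Shanks' proof of the pentagonal number theorem.

    module Pochhammer
      (P I : ℕ → Carrier)
      (P-zero : P 0 ≋ 1#)
      (P-suc : ∀ n → P (suc n) ≋ P n ⊗ (1# ⊖ x^ suc n))
      (P⊗I : ∀ n → P n ⊗ I n ≋ 1#)
      where

      P-suc-⊖ : ∀ n → P (suc n) ≋ P n ⊖ P n ⊗ x^ suc n
      P-suc-⊖ n = ≋-trans (P-suc n) (≋-trans (*-comm _ _)
        (≋-trans ([1-a]b _ _) (⊖-cong ≋-refl (*-comm _ _))))

      -- Brings neighbouring terms over the common denominator (x;x)_{n+1}. Its dilation is the
      -- hypothesis `J-suc` of `Euler`.
      I-suc : ∀ n → I n ≋ (1# ⊖ x^ suc n) ⊗ I (suc n)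
      I-suc n = begin
        I n                                              ≈⟨ *-identityʳ _ ⟨
        I n ⊗ 1#                                         ≈⟨ *-congˡ (P⊗I (suc n)) ⟨
        I n ⊗ (P (suc n) ⊗ I (suc n))                    ≈⟨ *-congˡ (*-congʳ (P-suc n)) ⟩
        I n ⊗ (P n ⊗ (1# ⊖ x^ suc n) ⊗ I (suc n))        ≈⟨ assoc′ (I n) (P n) _ (I (suc n)) ⟩
        P n ⊗ I n ⊗ ((1# ⊖ x^ suc n) ⊗ I (suc n))        ≈⟨ *-congʳ (P⊗I n) ⟩
        1# ⊗ ((1# ⊖ x^ suc n) ⊗ I (suc n))               ≈⟨ *-identityˡ _ ⟩
        (1# ⊖ x^ suc n) ⊗ I (suc n)                      ∎
        where
        assoc′ : ∀ a b c d → a ⊗ (b ⊗ c ⊗ d) ≋ b ⊗ a ⊗ (c ⊗ d)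
        assoc′ = solve 4 (λ a b c d → a :* (b :* c :* d) := b :* a :* (c :* d)) ≋-refl

      I-suc-⊖ : ∀ n → I n ≋ I (suc n) ⊖ x^ suc n ⊗ I (suc n)
      I-suc-⊖ n = ≋-trans (I-suc n) ([1-a]b _ _)

      I-zero : I 0 ≋ 1#
      I-zero = ≋-trans (≋-sym (*-identityˡ _)) (≋-trans (*-congʳ (≋-sym P-zero)) (P⊗I 0))

      shanks : ℕ → ℕ → Carrier
      shanks n s = sgn s ⊗ (P n ⊗ (I s ⊗ x^ (s ℕ.* n ℕ.+ T s)))

      shanks-diagonal : ∀ n → shanks n n ≋ sgn n ⊗ x^ p⁺ n
      shanks-diagonal n = *-congˡ (≋-trans (≋-sym (*-assoc _ _ _)) (≋-trans (*-congʳ (P⊗I n)) (*-identityˡ _)))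

      -- Write F_s for `shanks n s`. Since (1 - x^s)/(x;x)_s = 1/(x;x)_{s-1}, the product (1 - x^s)
      -- F_s is -x^{n+s} F_{s-1}. Hence `shanks (suc n) s` exceeds F_s by x^{n+s} F_{s-1} -
      -- x^{n+1+s} F_s, a difference of consecutive values of x^{n+1+s} F_s.
      shanks-telescope : ∀ n S →
        ∑< (suc S) (shanks (suc n)) ≋ ∑< (suc S) (shanks n) ⊖ x^ (suc n ℕ.+ S) ⊗ shanks n S
      shanks-telescope n zero = begin
        0# ⊕ 1# ⊗ (P (suc n) ⊗ (I 0 ⊗ x^ 0))
          ≈⟨ +-congˡ (*-congˡ (*-congʳ (P-suc-⊖ n))) ⟩
        0# ⊕ 1# ⊗ ((P n ⊖ P n ⊗ x^ suc n) ⊗ (I 0 ⊗ x^ 0))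
          ≈⟨ lemma 0# 1# (P n) (I 0) (x^ 0) (x^ suc n) ⟩
        0# ⊕ 1# ⊗ (P n ⊗ (I 0 ⊗ x^ 0)) ⊖ x^ suc n ⊗ (1# ⊗ (P n ⊗ (I 0 ⊗ x^ 0)))
          ≈⟨ ⊖-cong ≋-refl (*-congʳ (x^-cong (sym (ℕ.+-identityʳ (suc n))))) ⟩
        0# ⊕ shanks n 0 ⊖ x^ (suc n ℕ.+ 0) ⊗ shanks n 0 ∎
        where
        lemma : ∀ z σ p i w x → z ⊕ σ ⊗ ((p ⊖ p ⊗ x) ⊗ (i ⊗ w))
                              ≋ z ⊕ σ ⊗ (p ⊗ (i ⊗ w)) ⊖ x ⊗ (σ ⊗ (p ⊗ (i ⊗ w)))
        lemma = solve 6 (λ z σ p i w x → z :+ σ :* ((p :- p :* x) :* (i :* w))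
                              := z :+ σ :* (p :* (i :* w)) :- x :* (σ :* (p :* (i :* w)))) ≋-refl
      shanks-telescope n (suc S) = begin
        ∑< (suc S) (shanks (suc n)) ⊕ shanks (suc n) (suc S)
          ≈⟨ +-cong (shanks-telescope n S) (*-congˡ (*-cong (P-suc-⊖ n) (*-congˡ exponent₁))) ⟩
        Σ ⊖ x^ (suc n ℕ.+ S) ⊗ (σ ⊗ (p ⊗ (I S ⊗ w))) ⊕ ⊖ σ ⊗ ((p ⊖ p ⊗ x) ⊗ (i ⊗ (v ⊗ (y ⊗ w) ⊗ y)))
          -- With `I S` rewritten over `I (suc S)`, all terms are polynomials in the same
          -- quantities, and the boundary term of the induction hypothesis can cancel against the
          -- new summand.
          ≈⟨ +-congʳ (⊖-cong ≋-refl (*-cong exponent₂ (*-congˡ (*-congˡ (*-congʳ (I-suc-⊖ S)))))) ⟩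
        Σ ⊖ v ⊗ y ⊗ (σ ⊗ (p ⊗ ((i ⊖ y ⊗ i) ⊗ w))) ⊕ ⊖ σ ⊗ ((p ⊖ p ⊗ x) ⊗ (i ⊗ (v ⊗ (y ⊗ w) ⊗ y)))
          ≈⟨ lemma Σ v y σ p i w x ⟩
        Σ ⊕ ⊖ σ ⊗ (p ⊗ (i ⊗ (v ⊗ (y ⊗ w)))) ⊖ x ⊗ y ⊗ (⊖ σ ⊗ (p ⊗ (i ⊗ (v ⊗ (y ⊗ w)))))
          ≈⟨ ⊖-cong (+-congˡ shanks-suc) (*-cong (x^-+ (suc n) (suc S)) shanks-suc) ⟨
        Σ ⊕ shanks n (suc S) ⊖ x^ (suc n ℕ.+ suc S) ⊗ shanks n (suc S) ∎
        where
        Σ = ∑< (suc S) (shanks n)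
        e = S ℕ.* n ℕ.+ T S
        σ = sgn S
        p = P n
        i = I (suc S)
        v = x^ n
        w = x^ e
        x = x^ suc n
        y = x^ suc S

        split : x^ (n ℕ.+ (suc S ℕ.+ e)) ≋ v ⊗ (y ⊗ w)
        split = ≋-trans (x^-+ n (suc S ℕ.+ e)) (*-congˡ (x^-+ (suc S) e))

        exponent₀ : x^ (suc S ℕ.* n ℕ.+ T (suc S)) ≋ v ⊗ (y ⊗ w)
        exponent₀ = ≋-trans (x^-cong (arith n S (T S))) split
          where
          arith : ∀ n S t → n ℕ.+ S ℕ.* n ℕ.+ (ℕ.suc S ℕ.+ t) ≡ n ℕ.+ (ℕ.suc S ℕ.+ (S ℕ.* n ℕ.+ t))
          arith = ℕ.solve-∀

        exponent₁ : x^ (suc S ℕ.* suc n ℕ.+ T (suc S)) ≋ v ⊗ (y ⊗ w) ⊗ y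
        exponent₁ = ≋-trans (x^-cong (arith n S (T S))) (≋-trans (x^-+ _ (suc S)) (*-congʳ split))
          where
          arith : ∀ n S t → ℕ.suc S ℕ.* ℕ.suc n ℕ.+ (ℕ.suc S ℕ.+ t)
                          ≡ n ℕ.+ (ℕ.suc S ℕ.+ (S ℕ.* n ℕ.+ t)) ℕ.+ ℕ.suc S
          arith = ℕ.solve-∀

        exponent₂ : x^ (suc n ℕ.+ S) ≋ v ⊗ y
        exponent₂ = ≋-trans (x^-cong (sym (ℕ.+-suc n S))) (x^-+ n (suc S))

        shanks-suc : shanks n (suc S) ≋ ⊖ σ ⊗ (p ⊗ (i ⊗ (v ⊗ (y ⊗ w))))
        shanks-suc = *-congˡ (*-congˡ (*-congˡ exponent₀))

        lemma : ∀ Σ v y σ p i w x →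
          Σ ⊖ v ⊗ y ⊗ (σ ⊗ (p ⊗ ((i ⊖ y ⊗ i) ⊗ w))) ⊕ ⊖ σ ⊗ ((p ⊖ p ⊗ x) ⊗ (i ⊗ (v ⊗ (y ⊗ w) ⊗ y)))
          ≋ Σ ⊕ ⊖ σ ⊗ (p ⊗ (i ⊗ (v ⊗ (y ⊗ w)))) ⊖ x ⊗ y ⊗ (⊖ σ ⊗ (p ⊗ (i ⊗ (v ⊗ (y ⊗ w)))))
        lemma = solve 8 (λ Σ v y σ p i w x →
          Σ :- v :* y :* (σ :* (p :* ((i :- y :* i) :* w)))
            :+ (:- σ) :* ((p :- p :* x) :* (i :* (v :* (y :* w) :* y)))
          := Σ :+ (:- σ) :* (p :* (i :* (v :* (y :* w))))
               :- x :* y :* ((:- σ) :* (p :* (i :* (v :* (y :* w)))))) ≋-refl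

      -- From n to n + 1 the sum gains two terms: the boundary term of the telescoping, with
      -- exponent (2n + 1) + `p⁺ n` = `p⁻ (suc n)`, and the new diagonal term, with exponent
      -- `p⁺ (suc n)`.
      ∑-shanks : ∀ n → ∑< (suc n) (shanks n) ≋ pentagonal n
      ∑-shanks zero = ≋-trans (+-identityˡ _) (≋-trans (shanks-diagonal 0) (≋-trans (*-identityˡ _) x^0))
      ∑-shanks (suc n) = begin
        ∑< (suc n) (shanks (suc n)) ⊕ shanks (suc n) (suc n)
          ≈⟨ +-cong (shanks-telescope n n) (shanks-diagonal (suc n)) ⟩
        ∑< (suc n) (shanks n) ⊖ x^ (suc n ℕ.+ n) ⊗ shanks n n ⊕ sgn (suc n) ⊗ x^ p⁺ (suc n)
          ≈⟨ +-congʳ (⊖-cong (∑-shanks n) (*-congˡ (shanks-diagonal n))) ⟩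
        pentagonal n ⊖ x^ (suc n ℕ.+ n) ⊗ (sgn n ⊗ x^ p⁺ n) ⊕ ⊖ sgn n ⊗ x^ p⁺ (suc n)
          ≈⟨ lemma (pentagonal n) (x^ (suc n ℕ.+ n)) (sgn n) (x^ p⁺ n) (x^ p⁺ (suc n)) ⟩
        pentagonal n ⊕ sgn (suc n) ⊗ (x^ (suc n ℕ.+ n) ⊗ x^ p⁺ n ⊕ x^ p⁺ (suc n))
          ≈⟨ +-congˡ (*-congˡ (+-congʳ (x^-+ (suc n ℕ.+ n) (p⁺ n)))) ⟨
        pentagonal (suc n) ∎
        where
        lemma : ∀ a b σ c d → a ⊖ b ⊗ (σ ⊗ c) ⊕ ⊖ σ ⊗ d ≋ a ⊕ ⊖ σ ⊗ (b ⊗ c ⊕ d)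
        lemma = solve 5 (λ a b σ c d →
          a :- b :* (σ :* c) :+ (:- σ) :* d := a :+ (:- σ) :* (b :* c :+ d)) ≋-refl

      -- In the sum of `∑-shanks` every term with s ≥ 1 has exponent sn + s(s+1)/2 ≥ n + 1, so that
      -- modulo x^N only the term s = 0 is left, which is `P n`.
      pentagonal-number-theorem : ∀ n → N ≤ suc n → P n ≋ pentagonal n
      pentagonal-number-theorem n N≤1+n = begin
        P n                      ≈⟨ *-identityʳ _ ⟨
        P n ⊗ 1#                 ≈⟨ *-congˡ (≋-trans (*-cong I-zero x^0) (*-identityˡ _)) ⟨
        P n ⊗ (I 0 ⊗ x^ 0)       ≈⟨ *-identityˡ _ ⟨
        shanks n 0               ≈⟨ ∑<-head (shanks n) n tail ⟨
        ∑< (suc n) (shanks n)    ≈⟨ ∑-shanks n ⟩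
        pentagonal n             ∎
        where
        tail : ∀ s → shanks n (suc s) ≋ 0#
        tail s = ⊗-vanishes (⊗-vanishes (⊗-vanishes (x^-vanishes (ℕ.≤-trans N≤1+n
          (ℕ.≤-trans (ℕ.≤-reflexive (ℕ.+-comm 1 n))
          (ℕ.+-mono-≤ (ℕ.m≤m+n n (s ℕ.* n)) (s≤s z≤n)))))))

    -- Euler's expansion of (t;t²)_∞ and its splitting by parity.

    -- x^ n and J m stand for t^n and 1/(t²;t²)_m.
    module Euler
      (J : ℕ → Carrier)
      (J-zero : J 0 ≋ 1#)
      (J-suc : ∀ m → J m ≋ (1# ⊖ x^ double (suc m)) ⊗ J (suc m))
      where

      euler : ℕ → ℕ → Carrier
      euler k m = J m ⊗ (sgn m ⊗ x^ (m ℕ.* m ℕ.+ double k ℕ.* m))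

      oddPochhammer : ℕ → Carrier
      oddPochhammer zero    = 1#
      oddPochhammer (suc k) = oddPochhammer k ⊗ (1# ⊖ x^ suc (double k))

      -- Passing from k to k + 1 multiplies the term m by t^{2m}, and 1 - t^{2m} cancels the last
      -- factor of 1/(t²;t²)_m. So `euler k m` minus `euler (suc k) m` is -t^{2k+1} times
      -- `euler (suc k)` at m - 1, by m² + 2km = (2k + 1) + (m - 1)² + 2(k + 1)(m - 1). The shift of
      -- m makes the second sum one term shorter.
      euler-step : ∀ k M → ∑< (suc M) (euler k) ≋
        ∑< (suc M) (euler (suc k)) ⊖ x^ suc (double k) ⊗ ∑< M (euler (suc k))
      euler-step k zero = begin
        0# ⊕ euler k 0            ≈⟨ +-congˡ (*-congˡ (*-congˡ (x^-cong
                                      (trans (ℕ.*-zeroʳ (double k)) (sym (ℕ.*-zeroʳ (double (suc k)))))))) ⟩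
        0# ⊕ euler (suc k) 0      ≈⟨ lemma _ (x^ suc (double k) ⊗ 0#) (zeroʳ _) ⟨
        0# ⊕ euler (suc k) 0 ⊖ x^ suc (double k) ⊗ 0# ∎
        where
        lemma : ∀ a b → b ≋ 0# → a ⊖ b ≋ a
        lemma a b e = ≋-trans (⊖-cong (≋-sym (≋-trans (+-congˡ e) (+-identityʳ a))) ≋-refl) (cancel a b)
          where
          cancel : ∀ a b → a ⊕ b ⊖ b ≋ a
          cancel = solve 2 (λ a b → a :+ b :- b := a) ≋-refl
      euler-step k (suc M) = begin
        ∑< (suc M) (euler k) ⊕ j ⊗ (⊖ σ ⊗ x^ e)
          ≈⟨ +-cong (euler-step k M) (*-congˡ (*-congˡ exponent₁)) ⟩
        Σ₁ ⊖ u ⊗ Σ₀ ⊕ j ⊗ (⊖ σ ⊗ (u ⊗ v))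
          ≈⟨ lemma Σ₁ Σ₀ u j σ v z ⟩
        Σ₁ ⊕ j ⊗ (⊖ σ ⊗ (u ⊗ v ⊗ z)) ⊖ u ⊗ (Σ₀ ⊕ (j ⊖ z ⊗ j) ⊗ (σ ⊗ v))
          ≈⟨ ⊖-cong (+-congˡ (*-congˡ (*-congˡ exponent₂)))
                    (*-congˡ (+-congˡ (*-congʳ (≋-trans (J-suc M) ([1-a]b _ _))))) ⟨
        Σ₁ ⊕ euler (suc k) (suc M) ⊖ u ⊗ (Σ₀ ⊕ euler (suc k) M) ∎
        where
        Σ₁ = ∑< (suc M) (euler (suc k))
        Σ₀ = ∑< M (euler (suc k))
        e = suc M ℕ.* suc M ℕ.+ double k ℕ.* suc M
        e₀ = M ℕ.* M ℕ.+ double (suc k) ℕ.* M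
        u = x^ suc (double k)
        v = x^ e₀
        z = x^ double (suc M)
        j = J (suc M)
        σ = sgn M

        exponent₁ : x^ e ≋ u ⊗ v
        exponent₁ = ≋-trans (x^-cong (arith (double k) M)) (x^-+ (suc (double k)) e₀)
          where
          arith : ∀ d M → ℕ.suc M ℕ.* ℕ.suc M ℕ.+ d ℕ.* ℕ.suc M
                        ≡ ℕ.suc d ℕ.+ (M ℕ.* M ℕ.+ (2 ℕ.+ d) ℕ.* M)
          arith = ℕ.solve-∀

        exponent₂ : x^ (suc M ℕ.* suc M ℕ.+ double (suc k) ℕ.* suc M) ≋ u ⊗ v ⊗ z
        exponent₂ = ≋-trans
          (x^-cong (trans (arith (double k) M) (cong (e ℕ.+_) (sym (double≡+ (suc M))))))
          (≋-trans (x^-+ e (double (suc M))) (*-congʳ exponent₁))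
          where
          arith : ∀ d M → ℕ.suc M ℕ.* ℕ.suc M ℕ.+ (2 ℕ.+ d) ℕ.* ℕ.suc M
                        ≡ ℕ.suc M ℕ.* ℕ.suc M ℕ.+ d ℕ.* ℕ.suc M ℕ.+ (ℕ.suc M ℕ.+ ℕ.suc M)
          arith = ℕ.solve-∀

        lemma : ∀ Σ₁ Σ₀ u j σ v z → Σ₁ ⊖ u ⊗ Σ₀ ⊕ j ⊗ (⊖ σ ⊗ (u ⊗ v))
          ≋ Σ₁ ⊕ j ⊗ (⊖ σ ⊗ (u ⊗ v ⊗ z)) ⊖ u ⊗ (Σ₀ ⊕ (j ⊖ z ⊗ j) ⊗ (σ ⊗ v))
        lemma = solve 7 (λ Σ₁ Σ₀ u j σ v z → Σ₁ :- u :* Σ₀ :+ j :* ((:- σ) :* (u :* v))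
          := Σ₁ :+ j :* ((:- σ) :* (u :* v :* z)) :- u :* (Σ₀ :+ (j :- z :* j) :* (σ :* v))) ≋-refl

      -- The term by which the two sums of `euler-step` differ in length has exponent at least M² ≥
      -- N. Modulo t^N it can be added, and the factor 1 - t^{2k+1} splits off.
      euler-product : ∀ K M → N ≤ M ℕ.* M →
        ∑< (suc M) (euler 0) ≋ oddPochhammer K ⊗ ∑< (suc M) (euler K)
      euler-product zero    M N≤M² = ≋-sym (*-identityˡ _)
      euler-product (suc K) M N≤M² = begin
        ∑< (suc M) (euler 0)                    ≈⟨ euler-product K M N≤M² ⟩
        D ⊗ ∑< (suc M) (euler K)                ≈⟨ *-congˡ (euler-step K M) ⟩
        D ⊗ (Σ ⊖ u ⊗ ∑< M (euler (suc K)))      ≈⟨ *-congˡ (⊖-cong ≋-refl (*-congˡ (⊕-vanishes last))) ⟨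
        D ⊗ (Σ ⊖ u ⊗ Σ)                         ≈⟨ *-congˡ ([1-a]b u Σ) ⟨
        D ⊗ ((1# ⊖ u) ⊗ Σ)                      ≈⟨ *-assoc _ _ _ ⟨
        D ⊗ (1# ⊖ u) ⊗ Σ                        ∎
        where
        D = oddPochhammer K
        Σ = ∑< (suc M) (euler (suc K))
        u = x^ suc (double K)
        last : euler (suc K) M ≋ 0#
        last = ⊗-vanishes (⊗-vanishes (x^-vanishes (ℕ.≤-trans N≤M² (ℕ.m≤m+n _ _))))

      -- For m ≥ 1 the exponent m² + 2Km is at least 2K + 1 ≥ N, so f_K reduces to its term m = 0,
      -- which is 1.
      euler-identity : ∀ K M → N ≤ suc (double K) → N ≤ M ℕ.* M →
        ∑< (suc M) (euler 0) ≋ oddPochhammer K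
      euler-identity K M N≤2K+1 N≤M² = begin
        ∑< (suc M) (euler 0)                       ≈⟨ euler-product K M N≤M² ⟩
        oddPochhammer K ⊗ ∑< (suc M) (euler K)     ≈⟨ *-congˡ (∑<-head (euler K) M tail) ⟩
        oddPochhammer K ⊗ (J 0 ⊗ (1# ⊗ x^ (double K ℕ.* 0)))
          ≈⟨ *-congˡ (*-cong J-zero (*-congˡ (≋-trans (x^-cong (ℕ.*-zeroʳ (double K))) x^0))) ⟩
        oddPochhammer K ⊗ (1# ⊗ (1# ⊗ 1#))         ≈⟨ *-congˡ (≋-trans (*-identityˡ _) (*-identityˡ _)) ⟩
        oddPochhammer K ⊗ 1#                       ≈⟨ *-identityʳ _ ⟩
        oddPochhammer K                            ∎
        where
        tail : ∀ m → euler K (suc m) ≋ 0#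
        tail m = ⊗-vanishes (⊗-vanishes (x^-vanishes (ℕ.≤-trans N≤2K+1
          (ℕ.+-mono-≤ (s≤s (z≤n {m ℕ.+ m ℕ.* suc m})) (ℕ.m≤m*n (double K) (suc m))))))

      -- m² has the parity of m: (2j)² = 2 · 2j² and (2j + 1)² = 2 · 2j(j + 1) + 1. The exponents
      -- are displayed in this form for `even`.
      euler-parity : ∀ n → ∑< (double n) (euler 0) ≋
        ∑< n (λ j → J (double j) ⊗ x^ double (2 ℕ.* j ℕ.^ 2)
                  ⊕ J (suc (double j)) ⊗ ⊖ (x^ suc (double (2 ℕ.* (j ℕ.* suc j)))))
      euler-parity zero    = ≋-refl
      euler-parity (suc n) = begin
        ∑< (double n) (euler 0) ⊕ J₀ ⊗ (σ ⊗ x^ e₀) ⊕ J₁ ⊗ (⊖ σ ⊗ x^ e₁)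
          ≈⟨ +-cong (+-cong (euler-parity n) (*-congˡ (*-cong σ≋1 (x^-cong (exponent₀ n)))))
                    (*-congˡ (*-cong (-‿cong σ≋1) (x^-cong (exponent₁ n)))) ⟩
        Σ ⊕ J₀ ⊗ (1# ⊗ x₀) ⊕ J₁ ⊗ (⊖ 1# ⊗ x₁)
          ≈⟨ lemma Σ J₀ 1# x₀ J₁ x₁ ⟩
        Σ ⊕ (J₀ ⊗ (1# ⊗ x₀) ⊕ J₁ ⊗ ⊖ (1# ⊗ x₁))
          ≈⟨ +-congˡ (+-cong (*-congˡ (*-identityˡ _)) (*-congˡ (-‿cong (*-identityˡ _)))) ⟩
        Σ ⊕ (J₀ ⊗ x₀ ⊕ J₁ ⊗ ⊖ x₁) ∎
        where
        Σ = ∑< n (λ j → J (double j) ⊗ x^ double (2 ℕ.* j ℕ.^ 2)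
                      ⊕ J (suc (double j)) ⊗ ⊖ (x^ suc (double (2 ℕ.* (j ℕ.* suc j)))))
        J₀ = J (double n)
        J₁ = J (suc (double n))
        σ = sgn (double n)
        σ≋1 = sgn-double n
        e₀ = double n ℕ.* double n ℕ.+ 0
        e₁ = suc (double n) ℕ.* suc (double n) ℕ.+ 0
        x₀ = x^ double (2 ℕ.* n ℕ.^ 2)
        x₁ = x^ suc (double (2 ℕ.* (n ℕ.* suc n)))

        exponent₀ : ∀ n → double n ℕ.* double n ℕ.+ 0 ≡ double (2 ℕ.* n ℕ.^ 2)
        exponent₀ n = trans (cong (λ d → d ℕ.* d ℕ.+ 0) (double≡+ n))
          (trans (arith n) (sym (double≡+ (2 ℕ.* n ℕ.^ 2))))
          where
          arith : ∀ n → (n ℕ.+ n) ℕ.* (n ℕ.+ n) ℕ.+ 0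
                      ≡ 2 ℕ.* (n ℕ.* (n ℕ.* 1)) ℕ.+ 2 ℕ.* (n ℕ.* (n ℕ.* 1))
          arith = ℕ.solve-∀

        exponent₁ : ∀ n → suc (double n) ℕ.* suc (double n) ℕ.+ 0 ≡ suc (double (2 ℕ.* (n ℕ.* suc n)))
        exponent₁ n = trans (cong (λ d → suc d ℕ.* suc d ℕ.+ 0) (double≡+ n))
          (trans (arith n) (cong suc (sym (double≡+ (2 ℕ.* (n ℕ.* suc n))))))
          where
          arith : ∀ n → suc (n ℕ.+ n) ℕ.* suc (n ℕ.+ n) ℕ.+ 0
                      ≡ suc (2 ℕ.* (n ℕ.* suc n) ℕ.+ 2 ℕ.* (n ℕ.* suc n))
          arith = ℕ.solve-∀

        lemma : ∀ s a o b c d → s ⊕ a ⊗ (o ⊗ b) ⊕ c ⊗ (⊖ o ⊗ d) ≋ s ⊕ (a ⊗ (o ⊗ b) ⊕ c ⊗ ⊖ (o ⊗ d))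
        lemma = solve 6 (λ s a o b c d → s :+ a :* (o :* b) :+ c :* ((:- o) :* d)
                                  := s :+ (a :* (o :* b) :+ c :* (:- (o :* d)))) ≋-refl

      module _
        (P Q : ℕ → Carrier)
        (P-zero : P 0 ≋ 1#)
        (P-suc : ∀ n → P (suc n) ≋ P n ⊗ (1# ⊖ x^ suc n))
        (Q-zero : Q 0 ≋ 1#)
        (Q-suc : ∀ n → Q (suc n) ≋ Q n ⊗ (1# ⊖ x^ double (suc n)))
        where

        -- With `P n` = (t;t)_n and `Q n` = (t²;t²)_n: the 2K factors of (t;t)_{2K} are sorted by
        -- the parity of their exponents.
        Q⊗oddPochhammer : ∀ K → Q K ⊗ oddPochhammer K ≋ P (double K)
        Q⊗oddPochhammer zero    = ≋-trans (*-identityʳ _) (≋-trans Q-zero (≋-sym P-zero))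
        Q⊗oddPochhammer (suc K) = begin
          Q (suc K) ⊗ (oddPochhammer K ⊗ a)       ≈⟨ *-congʳ (Q-suc K) ⟩
          Q K ⊗ b ⊗ (oddPochhammer K ⊗ a)         ≈⟨ lemma (Q K) b (oddPochhammer K) a ⟩
          Q K ⊗ oddPochhammer K ⊗ a ⊗ b           ≈⟨ *-congʳ (*-congʳ (Q⊗oddPochhammer K)) ⟩
          P (double K) ⊗ a ⊗ b                    ≈⟨ *-congʳ (P-suc (double K)) ⟨
          P (suc (double K)) ⊗ b                  ≈⟨ P-suc (suc (double K)) ⟨
          P (double (suc K))                      ∎
          where
          a = 1# ⊖ x^ suc (double K)
          b = 1# ⊖ x^ double (suc K)
          lemma : ∀ q b d a → q ⊗ b ⊗ (d ⊗ a) ≋ q ⊗ d ⊗ a ⊗ b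
          lemma = solve 4 (λ q b d a → q :* b :* (d :* a) := q :* d :* a :* b) ≋-refl

-- Power series

infixr 8 -ˢ_
infixl 7 _·_

-ˢ_ : PowerSeries → PowerSeries
(-ˢ A) n = ℤ.- A n

-- By computation `(A *ˢ B) ∘ suc` is `A 0 · (B ∘ suc) +ˢ (A ∘ suc) *ˢ B`; the inductions for
-- `*ˢ-assoc` and `dilate-*` rest on this.
_·_ : ℤ → PowerSeries → PowerSeries
(a · B) n = a * B n

private
  variable
    A A′ B B′ : PowerSeries

*ˢ-cong : A ≈ A′ → B ≈ B′ → A *ˢ B ≈ A′ *ˢ B′
*ˢ-cong a b n = *ˢ-cong-≤ n (λ i _ → a i) (λ i _ → b i)

-- The convolution unfolds at its first term; commutativity compares this with unfolding at the
-- last.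
*ˢ-suc : ∀ A B n → (A *ˢ B) (suc n) ≡ A (suc n) * B 0 + (A *ˢ (B ∘ suc)) n
*ˢ-suc A B zero = swap (A 0 * B 1) (A 1 * B 0)
  where
  swap : ∀ x y → x + (y + 0ℤ) ≡ y + (x + 0ℤ)
  swap = solve-∀
*ˢ-suc A B (suc n) = trans
  (cong (λ x → A 0 * B (suc (suc n)) + x) (*ˢ-suc (A ∘ suc) B n))
  (swap (A 0 * B (suc (suc n))) (A (suc (suc n)) * B 0) _)
  where
  swap : ∀ x y z → x + (y + z) ≡ y + (x + z)
  swap = solve-∀

*ˢ-comm : ∀ A B → A *ˢ B ≈ B *ˢ A
*ˢ-comm A B zero    = cong (_+ 0ℤ) (ℤ.*-comm (A 0) (B 0))
*ˢ-comm A B (suc n) = trans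
  (cong₂ _+_ (ℤ.*-comm (A 0) (B (suc n))) (*ˢ-comm (A ∘ suc) B n))
  (sym (*ˢ-suc B A n))

·-*ˢ : ∀ a B C → (a · B) *ˢ C ≈ a · (B *ˢ C)
·-*ˢ a B C zero = assoc a (B 0) (C 0)
  where
  assoc : ∀ x y z → x * y * z + 0ℤ ≡ x * (y * z + 0ℤ)
  assoc = solve-∀
·-*ˢ a B C (suc n) = trans
  (cong (λ x → a * B 0 * C (suc n) + x) (·-*ˢ a (B ∘ suc) C n))
  (assoc a (B 0) (C (suc n)) _)
  where
  assoc : ∀ x y z w → x * y * z + x * w ≡ x * (y * z + w)
  assoc = solve-∀

*ˢ-assoc : ∀ A B C → (A *ˢ B) *ˢ C ≈ A *ˢ (B *ˢ C)
*ˢ-assoc A B C zero = assoc (A 0) (B 0) (C 0)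
  where
  assoc : ∀ x y z → (x * y + 0ℤ) * z + 0ℤ ≡ x * (y * z + 0ℤ) + 0ℤ
  assoc = solve-∀
*ˢ-assoc A B C (suc n) = trans
  (cong (λ x → (A 0 * B 0 + 0ℤ) * C (suc n) + x) (trans
    (*ˢ-distribʳ (A 0 · (B ∘ suc)) ((A ∘ suc) *ˢ B) C n)
    (cong₂ _+_ (·-*ˢ (A 0) (B ∘ suc) C n) (*ˢ-assoc (A ∘ suc) B C n))))
  (regroup (A 0) (B 0) (C (suc n)) _ _)
  where
  regroup : ∀ x y z v w → (x * y + 0ℤ) * z + (x * v + w) ≡ x * (y * z + v) + w
  regroup = solve-∀

q^-suc : ∀ k → (q^ suc k) ∘ suc ≈ q^ k
q^-suc k n = cong (λ b → if b then 1ℤ else 0ℤ)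
  -- `does` of `suc n ≟ suc k` computes to that of `n ≟ k`, whereas `⌊_⌋` is stuck.
  (trans (isYes≗does (suc n ℕ.≟ suc k)) (sym (isYes≗does (n ℕ.≟ k))))

q^-*ˢ-suc : ∀ k A n → (q^ suc k *ˢ A) (suc n) ≡ (q^ k *ˢ A) n
q^-*ˢ-suc k A n = trans (ℤ.+-identityˡ _) (*ˢ-cong {B = A} (q^-suc k) (λ _ → refl) n)

q^-homo : ∀ a b → q^ (a ℕ.+ b) ≈ q^ a *ˢ q^ b
q^-homo zero    b n       = sym (*ˢ-identityˡ (q^ b) n)
q^-homo (suc a) b zero    = refl
q^-homo (suc a) b (suc n) = trans (q^-suc (a ℕ.+ b) n)
  (trans (q^-homo a b n) (sym (q^-*ˢ-suc a (q^ b) n)))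

constant : ℤ → PowerSeries
constant a zero    = a
constant a (suc _) = 0ℤ

constant-0 : constant 0ℤ ≈ 0ˢ
constant-0 zero    = refl
constant-0 (suc n) = refl

constant-1 : constant 1ℤ ≈ 1ˢ
constant-1 zero    = refl
constant-1 (suc n) = refl

constant-+ : ∀ a b → constant (a + b) ≈ constant a +ˢ constant b
constant-+ a b zero    = refl
constant-+ a b (suc n) = refl

constant-* : ∀ a b → constant (a * b) ≈ constant a *ˢ constant b
constant-* a b zero    = sym (ℤ.+-identityʳ (a * b))
constant-* a b (suc n) = sym (cong₂ _+_ (ℤ.*-zeroʳ a)
  (*ˢ-vanishes {constant a ∘ suc} (constant b) n (λ _ _ → refl)))

constant-neg : ∀ a → constant (ℤ.- a) ≈ -ˢ constant a
constant-neg a zero    = refl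
constant-neg a (suc n) = refl

-- The substitution q = t² and the even part in t.

-- A(q) ↦ A(q²)
dilate : PowerSeries → PowerSeries
dilate A zero          = A 0
dilate A (suc zero)    = 0ℤ
dilate A (suc (suc n)) = dilate (A ∘ suc) n

even : PowerSeries → PowerSeries
even A n = A (double n)

dilate-cong : A ≈ B → dilate A ≈ dilate B
dilate-cong a zero          = a 0
dilate-cong a (suc zero)    = refl
dilate-cong a (suc (suc n)) = dilate-cong (a ∘ suc) n

-- The combination has the shape of a shifted product, as `dilate-*` requires; a = -1 gives
-- differences.
dilate-linear : ∀ a B C → dilate (a · B +ˢ C) ≈ a · dilate B +ˢ dilate C
dilate-linear a B C zero          = refl
dilate-linear a B C (suc zero)    = sym (trans (ℤ.+-identityʳ _) (ℤ.*-zeroʳ a))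
dilate-linear a B C (suc (suc n)) = dilate-linear a (B ∘ suc) (C ∘ suc) n

dilate-* : ∀ A B → dilate (A *ˢ B) ≈ dilate A *ˢ dilate B
dilate-* A B zero          = refl
dilate-* A B (suc zero)    = sym (trans (ℤ.+-identityʳ _) (ℤ.*-zeroʳ (A 0)))
dilate-* A B (suc (suc n)) = trans
  (dilate-linear (A 0) (B ∘ suc) ((A ∘ suc) *ˢ B) n)
  (cong (λ x → A 0 * dilate B (suc (suc n)) + x)
    (trans (dilate-* (A ∘ suc) B n) (sym (ℤ.+-identityˡ _))))

dilate-0 : dilate 0ˢ ≈ 0ˢ
dilate-0 zero          = refl
dilate-0 (suc zero)    = refl
dilate-0 (suc (suc n)) = dilate-0 n

dilate-q^ : ∀ k → dilate (q^ k) ≈ q^ double k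
dilate-q^ zero    zero          = refl
dilate-q^ zero    (suc zero)    = refl
dilate-q^ zero    (suc (suc n)) = dilate-0 n
dilate-q^ (suc k) zero          = refl
dilate-q^ (suc k) (suc zero)    = sym (q^-suc (suc (double k)) 0)
dilate-q^ (suc k) (suc (suc n)) = trans (dilate-cong (q^-suc k) n)
  (trans (dilate-q^ k n)
  (sym (trans (q^-suc (suc (double k)) (suc n)) (q^-suc (double k) n))))

dilate-1-q^ : ∀ k → dilate (1ˢ -ˢ q^ k) ≈ 1ˢ -ˢ q^ double k
dilate-1-q^ k n = begin
  dilate (1ˢ -ˢ q^ k) n                   ≡⟨ dilate-cong (λ i → lemma (1ˢ i) ((q^ k) i)) n ⟩
  dilate (-1ℤ · q^ k +ˢ 1ˢ) n             ≡⟨ dilate-linear -1ℤ (q^ k) 1ˢ n ⟩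
  -1ℤ * dilate (q^ k) n + dilate 1ˢ n     ≡⟨ cong₂ (λ x y → -1ℤ * x + y) (dilate-q^ k n) (dilate-q^ 0 n) ⟩
  -1ℤ * (q^ double k) n + 1ˢ n            ≡⟨ sym (lemma (1ˢ n) ((q^ double k) n)) ⟩
  1ˢ n - (q^ double k) n                  ∎
  where
  open ≡-Reasoning
  lemma : ∀ x y → x - y ≡ -1ℤ * y + x
  lemma = solve-∀

-- A series in t² has no odd coefficients, so the even coefficients of the product involve only
-- those of `B`.
even-dilate-* : ∀ A B → even (dilate A *ˢ B) ≈ A *ˢ even B
even-dilate-* A B zero    = refl
even-dilate-* A B (suc n) =
  cong (λ x → A 0 * even B (suc n) + x)
    (trans (ℤ.+-identityˡ _) (even-dilate-* (A ∘ suc) B n))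

even-q^-suc² : ∀ k n → even (q^ suc (suc k)) (suc n) ≡ even (q^ k) n
even-q^-suc² k n = trans (q^-suc (suc k) (suc (double n))) (q^-suc k (double n))

even-q^-double : ∀ k → even (q^ double k) ≈ q^ k
even-q^-double zero    zero    = refl
even-q^-double zero    (suc n) = refl
even-q^-double (suc k) zero    = refl
even-q^-double (suc k) (suc n) = trans (even-q^-suc² (double k) n)
  (trans (even-q^-double k n) (sym (q^-suc k n)))

even-q^-odd : ∀ k → even (q^ suc (double k)) ≈ 0ˢ
even-q^-odd zero    zero    = refl
even-q^-odd zero    (suc n) = q^-suc 0 (suc (double n))
even-q^-odd (suc k) zero    = refl
even-q^-odd (suc k) (suc n) = trans (even-q^-suc² (suc (double k)) n) (even-q^-odd k n)

-- Finite sums of power series.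

open Sum _+ˢ_ 0ˢ

∑<-stable : ∀ f i n d → (∀ j → n ≤ j → f j i ≡ 0ℤ) → ∑< (d ℕ.+ n) f i ≡ ∑< n f i
∑<-stable f i n zero    v = refl
∑<-stable f i n (suc d) v = trans
  (cong₂ _+_ (∑<-stable f i n d v) (v (d ℕ.+ n) (ℕ.m≤n+m n d)))
  (ℤ.+-identityʳ _)

foldr-++ : ∀ xs ys → foldr _+_ 0ℤ (xs ++ ys) ≡ foldr _+_ 0ℤ xs + foldr _+_ 0ℤ ys
foldr-++ []       ys = sym (ℤ.+-identityˡ _)
foldr-++ (x ∷ xs) ys = trans (cong (λ y → x + y) (foldr-++ xs ys)) (sym (ℤ.+-assoc x _ _))

foldr-upTo : ∀ f i n → foldr _+_ 0ℤ (map (λ j → f j i) (upTo n)) ≡ ∑< n f i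
foldr-upTo f i zero    = refl
foldr-upTo f i (suc n) = begin
  -- `upTo` unfolds at the front but `∑<` at the end.
  foldr _+_ 0ℤ (map g (upTo (suc n)))        ≡⟨ cong (foldr _+_ 0ℤ ∘ map g) (sym (List.upTo-∷ʳ n)) ⟩
  foldr _+_ 0ℤ (map g (upTo n ++ n ∷ []))    ≡⟨ cong (foldr _+_ 0ℤ) (List.map-++ g (upTo n) (n ∷ [])) ⟩
  foldr _+_ 0ℤ (map g (upTo n) ++ g n ∷ [])  ≡⟨ foldr-++ (map g (upTo n)) (g n ∷ []) ⟩
  foldr _+_ 0ℤ (map g (upTo n)) + (g n + 0ℤ) ≡⟨ cong₂ _+_ (foldr-upTo f i n) (ℤ.+-identityʳ (g n)) ⟩
  ∑< n f i + g n                             ∎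
  where
  open ≡-Reasoning
  g = λ j → f j i

-- The ring of power series modulo q^N.

infix 4 _≡[_]_

-- Congruence modulo q^N. As a record it shows both series to unification instead of unfolding them
-- into coefficients.
record _≡[_]_ (A : PowerSeries) (N : ℕ) (B : PowerSeries) : Set where
  constructor coefficients
  field coefficient : ∀ i → i < N → A i ≡ B i

open _≡[_]_

module Truncated (N : ℕ) where

  infix 4 _≋_

  _≋_ : PowerSeries → PowerSeries → Set
  A ≋ B = A ≡[ N ] B

  ≈⇒≋ : A ≈ B → A ≋ B
  ≈⇒≋ a = coefficients λ i _ → a i

  *ˢ-cong-≋ : A ≋ A′ → B ≋ B′ → A *ˢ B ≋ A′ *ˢ B′
  *ˢ-cong-≋ a b = coefficients λ i i<N → *ˢ-cong-≤ i
    (λ j j≤i → coefficient a j (ℕ.≤-<-trans j≤i i<N))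
    (λ j j≤i → coefficient b j (ℕ.≤-<-trans j≤i i<N))

  commutativeRing : CommutativeRing 0ℓ 0ℓ
  commutativeRing = record
    { Carrier = PowerSeries
    ; _≈_ = _≋_
    ; _+_ = _+ˢ_
    ; _*_ = _*ˢ_
    ; -_ = -ˢ_
    ; 0# = 0ˢ
    ; 1# = 1ˢ
    ; isCommutativeRing = record
      { isRing = record
        { +-isAbelianGroup = record
          { isGroup = record
            { isMonoid = record
              { isSemigroup = record
                { isMagma = record
                  { isEquivalence = record
                    { refl = ≈⇒≋ λ _ → refl
                    ; sym = λ a → coefficients λ i i<N → sym (coefficient a i i<N)
                    ; trans = λ a b → coefficients λ i i<N →
                        trans (coefficient a i i<N) (coefficient b i i<N)
                    }
                  ; ∙-cong = λ a b → coefficients λ i i<N →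
                      cong₂ _+_ (coefficient a i i<N) (coefficient b i i<N)
                  }
                ; assoc = λ A B C → ≈⇒≋ λ i → ℤ.+-assoc (A i) (B i) (C i)
                }
              ; identity = (λ A → ≈⇒≋ λ i → ℤ.+-identityˡ (A i))
                         , (λ A → ≈⇒≋ λ i → ℤ.+-identityʳ (A i))
              }
            ; inverse = (λ A → ≈⇒≋ λ i → ℤ.+-inverseˡ (A i))
                      , (λ A → ≈⇒≋ λ i → ℤ.+-inverseʳ (A i))
            ; ⁻¹-cong = λ a → coefficients λ i i<N → cong ℤ.-_ (coefficient a i i<N)
            }
          ; comm = λ A B → ≈⇒≋ λ i → ℤ.+-comm (A i) (B i)
          }
        ; *-cong = *ˢ-cong-≋
        ; *-assoc = λ A B C → ≈⇒≋ (*ˢ-assoc A B C)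
        ; *-identity = (λ A → ≈⇒≋ (*ˢ-identityˡ A)) , (λ A → ≈⇒≋ (*ˢ-identityʳ A))
        ; distrib =
            (λ A B C → ≈⇒≋ λ i → trans (*ˢ-comm A (B +ˢ C) i)
              (trans (*ˢ-distribʳ B C A i)
                (cong₂ _+_ (*ˢ-comm B A i) (*ˢ-comm C A i))))
          , (λ A B C → ≈⇒≋ (*ˢ-distribʳ B C A))
        }
      ; *-comm = λ A B → ≈⇒≋ (*ˢ-comm A B)
      }
    }

  open CommutativeRing commutativeRing public using ()
    renaming (refl to ≋-refl; sym to ≋-sym; trans to ≋-trans)

  constant-morphism : CommutativeRing.rawRing ℤ.+-*-commutativeRing
                        -Raw-AlmostCommutative⟶ fromCommutativeRing commutativeRing
  constant-morphism = record
    { ⟦_⟧    = constant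
    ; +-homo = λ a b → ≈⇒≋ (constant-+ a b)
    ; *-homo = λ a b → ≈⇒≋ (constant-* a b)
    ; -‿homo = λ a → ≈⇒≋ (constant-neg a)
    ; 0-homo = ≈⇒≋ constant-0
    ; 1-homo = ≈⇒≋ constant-1
    }

  open Identities.Powers commutativeRing constant-morphism q^_ ≋-refl
    (λ a b → ≈⇒≋ (q^-homo a b)) N
    (λ N≤k → coefficients λ i i<N → q^-below _ i (ℕ.<-≤-trans i<N N≤k))
    public

  open Pochhammer qPoch (1/ˢ_ ∘ qPoch) ≋-refl (λ _ → ≋-refl)
    (λ n → ≈⇒≋ (*ˢ-inverseʳ (qPoch n) (qPoch-constant n)))
    public

-- Dilated Pochhammer symbols and the even part of Euler's sum.

1/qPoch-zero : 1/ˢ qPoch 0 ≈ 1ˢ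
1/qPoch-zero i = coefficient (Truncated.I-zero (suc i)) i (ℕ.n<1+n i)

-- A congruence modulo every power of q is an identity: coefficient i is read off modulo q^{i+1}.
1/qPoch-suc : ∀ s → 1/ˢ qPoch s ≈ (1ˢ -ˢ q^ suc s) *ˢ 1/ˢ qPoch (suc s)
1/qPoch-suc s i = coefficient (Truncated.I-suc (suc i) s) i (ℕ.n<1+n i)

dilate-1-q^-* : ∀ k A → dilate ((1ˢ -ˢ q^ k) *ˢ A) ≈ (1ˢ -ˢ q^ double k) *ˢ dilate A
dilate-1-q^-* k A n = trans (dilate-* (1ˢ -ˢ q^ k) A n)
  (*ˢ-cong {B = dilate A} (dilate-1-q^ k) (λ _ → refl) n)

dilate-qPoch-suc : ∀ n → dilate (qPoch (suc n)) ≈ dilate (qPoch n) *ˢ (1ˢ -ˢ q^ double (suc n))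
dilate-qPoch-suc n i = trans (dilate-* (qPoch n) (1ˢ -ˢ q^ suc n) i)
  (*ˢ-cong {A = dilate (qPoch n)} (λ _ → refl) (dilate-1-q^ (suc n)) i)

-- The coefficients of q^0, ..., q^L are those of t^0, t^2, ..., t^{2L}, which are known modulo
-- t^{2L+1}.
even-cong : ∀ L → A ≡[ suc (double L) ] B → even A ≡[ suc L ] even B
even-cong L a .coefficient i (s≤s i≤L) = coefficient a (double i) (s≤s (double-mono-≤ i≤L))

even-dilate-q^ : ∀ A k → even (dilate A *ˢ q^ double k) ≈ q^ k *ˢ A
even-dilate-q^ A k n = trans (even-dilate-* A (q^ double k) n)
  (trans (*ˢ-cong {A = A} (λ _ → refl) (even-q^-double k) n) (*ˢ-comm A (q^ k) n))

even-dilate-q^-odd : ∀ A k → even (dilate A *ˢ -ˢ q^ suc (double k)) ≈ 0ˢ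
even-dilate-q^-odd A k n = trans (even-dilate-* A (-ˢ q^ suc (double k)) n)
  (trans (*ˢ-cong {A = A} (λ _ → refl) (λ i → cong ℤ.-_ (even-q^-odd k i)) n)
  (trans (*ˢ-comm A (λ _ → 0ℤ) n) (*ˢ-vanishes A n (λ _ _ → refl))))

lhs : ℕ → PowerSeries
lhs n = q^ (2 ℕ.* n ℕ.^ 2) /ˢ qPoch (2 ℕ.* n)

-- Applied to the right side of `euler-parity`: the index m = 2j leaves the summand j of the
-- theorem, and m = 2j + 1 is an odd power of t times a series in t².
even-parity : ∀ n → even (∑< n (λ j →
    dilate (1/ˢ qPoch (double j)) *ˢ q^ double (2 ℕ.* j ℕ.^ 2)
    +ˢ dilate (1/ˢ qPoch (suc (double j))) *ˢ -ˢ q^ suc (double (2 ℕ.* (j ℕ.* suc j)))))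
  ≈ ∑< n lhs
even-parity zero    i = refl
even-parity (suc n) i = cong₂ _+_ (even-parity n i) (trans
  (cong₂ _+_ (even-dilate-q^ (1/ˢ qPoch (double n)) (2 ℕ.* n ℕ.^ 2) i)
             (even-dilate-q^-odd (1/ˢ qPoch (suc (double n))) (2 ℕ.* (n ℕ.* suc n)) i))
  (trans (ℤ.+-identityʳ _)
    (cong (λ m → (q^ (2 ℕ.* n ℕ.^ 2) /ˢ qPoch m) i)
      (trans (double≡+ n) (cong (n ℕ.+_) (sym (ℕ.+-identityʳ n)))))))

-- Matching the exponents with pentagonal numbers.

e₁ e₂ : ℤ → ℕ
e₁ k = ∣ + 12 * k ^ 2 + k ∣
e₂ k = ∣ + 12 * k ^ 2 + + 7 * k + + 1 ∣

rhs : ℤ → PowerSeries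
rhs k = q^ e₁ k -ˢ q^ e₂ k

-- The common form in which the integer exponents of the theorem meet the natural pentagonal
-- numbers.
quadratic : ℕ → ℕ → ℕ → ℕ → ℕ
quadratic a b c n = a ℕ.+ b ℕ.* n ℕ.+ c ℕ.* (n ℕ.* n)

∣∣-quadratic : ∀ a b c n {e} → e ≡ + a + + b * + n + + c * (+ n * + n) → ∣ e ∣ ≡ quadratic a b c n
∣∣-quadratic a b c n e≡ = cong ∣_∣ (trans e≡ (sym
  (cong₂ (λ x y → + a + x + y) (ℤ.pos-* b n)
    (trans (ℤ.pos-* c (n ℕ.* n)) (cong (λ x → + c * x) (ℤ.pos-* n n))))))

e₁-pos : ∀ n → e₁ (+ suc n) ≡ quadratic 13 25 12 n
e₁-pos n = ∣∣-quadratic 13 25 12 n (lemma (+ n))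
  where
  lemma : ∀ x → + 12 * ((1ℤ + x) * ((1ℤ + x) * 1ℤ)) + (1ℤ + x) ≡ + 13 + + 25 * x + + 12 * (x * x)
  lemma = solve-∀

e₁-neg : ∀ n → e₁ -[1+ n ] ≡ quadratic 11 23 12 n
e₁-neg n = ∣∣-quadratic 11 23 12 n (lemma (+ n) refl)
  where
  expand : ∀ x → + 12 * (ℤ.- (1ℤ + x) * (ℤ.- (1ℤ + x) * 1ℤ)) + ℤ.- (1ℤ + x)
               ≡ + 11 + + 23 * x + + 12 * (x * x)
  expand = solve-∀
  -- The solver needs `-[1+ n ]` written as the negation of 1 + n; at x = `+ n` the two agree by
  -- computation.
  lemma : ∀ x {k} → k ≡ ℤ.- (1ℤ + x) → + 12 * k ^ 2 + k ≡ + 11 + + 23 * x + + 12 * (x * x)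
  lemma x refl = expand x

e₂-pos : ∀ n → e₂ (+ n) ≡ quadratic 1 7 12 n
e₂-pos n = ∣∣-quadratic 1 7 12 n (lemma (+ n))
  where
  lemma : ∀ x → + 12 * (x * (x * 1ℤ)) + + 7 * x + 1ℤ ≡ 1ℤ + + 7 * x + + 12 * (x * x)
  lemma = solve-∀

e₂-neg : ∀ n → e₂ -[1+ n ] ≡ quadratic 6 17 12 n
e₂-neg n = ∣∣-quadratic 6 17 12 n (lemma (+ n) refl)
  where
  expand : ∀ x → + 12 * (ℤ.- (1ℤ + x) * (ℤ.- (1ℤ + x) * 1ℤ)) + + 7 * ℤ.- (1ℤ + x) + 1ℤ
               ≡ + 6 + + 17 * x + + 12 * (x * x)
  expand = solve-∀
  lemma : ∀ x {k} → k ≡ ℤ.- (1ℤ + x) →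
          + 12 * k ^ 2 + + 7 * k + 1ℤ ≡ + 6 + + 17 * x + + 12 * (x * x)
  lemma x refl = expand x

double-injective : ∀ m n → double m ≡ double n → m ≡ n
double-injective zero    zero    e = refl
double-injective (suc m) (suc n) e = cong suc (double-injective m n (ℕ.suc-injective (ℕ.suc-injective e)))

double-+ : ∀ m n → double (m ℕ.+ n) ≡ double m ℕ.+ double n
double-+ zero    n = refl
double-+ (suc m) n = cong (suc ∘ suc) (double-+ m n)

-- Pentagonal numbers are compared after doubling, which turns them into polynomials over the
-- naturals.
double-T : ∀ n → double (T n) ≡ n ℕ.* suc n
double-T zero    = refl
double-T (suc n) = trans (double-+ (suc n) (T n))
  (trans (cong₂ ℕ._+_ (double≡+ (suc n)) (double-T n)) (arith n))
  where
  arith : ∀ n → suc n ℕ.+ suc n ℕ.+ n ℕ.* suc n ≡ suc n ℕ.* suc (suc n)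
  arith = ℕ.solve-∀

double-p⁺ : ∀ n → double (p⁺ n) ≡ n ℕ.* (3 ℕ.* n ℕ.+ 1)
double-p⁺ n = trans (double-+ (n ℕ.* n) (T n))
  (trans (cong₂ ℕ._+_ (double≡+ (n ℕ.* n)) (double-T n)) (arith n))
  where
  arith : ∀ n → n ℕ.* n ℕ.+ n ℕ.* n ℕ.+ n ℕ.* suc n ≡ n ℕ.* (3 ℕ.* n ℕ.+ 1)
  arith = ℕ.solve-∀

double-p⁻ : ∀ n → double (p⁻ (suc n)) ≡ suc n ℕ.* (3 ℕ.* n ℕ.+ 2)
double-p⁻ n = trans (double-+ (suc n ℕ.+ n) (p⁺ n))
  (trans (cong₂ ℕ._+_ (double≡+ (suc n ℕ.+ n)) (double-p⁺ n)) (arith n))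
  where
  arith : ∀ n → suc n ℕ.+ n ℕ.+ (suc n ℕ.+ n) ℕ.+ n ℕ.* (3 ℕ.* n ℕ.+ 1) ≡ suc n ℕ.* (3 ℕ.* n ℕ.+ 2)
  arith = ℕ.solve-∀

quadruple : ∀ n → double (double n) ≡ 4 ℕ.* n
quadruple n = trans (double≡+ (double n)) (trans (cong (λ m → m ℕ.+ m) (double≡+ n)) (arith n))
  where
  arith : ∀ n → n ℕ.+ n ℕ.+ (n ℕ.+ n) ≡ 4 ℕ.* n
  arith = ℕ.solve-∀

-- The parity of p is read off from its double: 2p = 4e forces p = 2e, and in the odd case 2p = 4e +
-- 2 forces p = 2e + 1.
even-q^-half-even : ∀ p {m} e → double p ≡ m → m ≡ 4 ℕ.* e → even (q^ p) ≈ q^ e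
even-q^-half-even p e p≡ m≡
  with refl ← double-injective p (double e) (trans p≡ (trans m≡ (sym (quadruple e))))
  = even-q^-double e

even-q^-half-odd : ∀ p {m} e → double p ≡ m → m ≡ 2 ℕ.+ 4 ℕ.* e → even (q^ p) ≈ 0ˢ
even-q^-half-odd p e p≡ m≡
  with refl ← double-injective p (suc (double e))
                (trans p≡ (trans m≡ (cong (2 ℕ.+_) (sym (quadruple e)))))
  = even-q^-odd e

module PentagonalExponents (j : ℕ) where

  n : ℕ
  n = double (double j)

  n≡4j : n ≡ 4 ℕ.* j
  n≡4j = quadruple j

  p⁺-at : ∀ i → double (p⁺ (i ℕ.+ n)) ≡ (i ℕ.+ 4 ℕ.* j) ℕ.* (3 ℕ.* (i ℕ.+ 4 ℕ.* j) ℕ.+ 1)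
  p⁺-at i = trans (double-p⁺ (i ℕ.+ n)) (cong (λ m → (i ℕ.+ m) ℕ.* (3 ℕ.* (i ℕ.+ m) ℕ.+ 1)) n≡4j)

  p⁻-at : ∀ i → double (p⁻ (suc i ℕ.+ n)) ≡ (suc i ℕ.+ 4 ℕ.* j) ℕ.* (3 ℕ.* (i ℕ.+ 4 ℕ.* j) ℕ.+ 2)
  p⁻-at i = trans (double-p⁻ (i ℕ.+ n)) (cong (λ m → (suc i ℕ.+ m) ℕ.* (3 ℕ.* (i ℕ.+ m) ℕ.+ 2)) n≡4j)

  p₁⁻ : even (q^ p⁻ (1 ℕ.+ n)) ≈ 0ˢ
  -- Here and below the polynomial is p/2 for an even exponent p and (p - 1)/2 for an odd one.
  p₁⁻ = even-q^-half-odd (p⁻ (1 ℕ.+ n)) (quadratic 0 5 12 j) (p⁻-at 0) (arith j)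
    where
    arith : ∀ j → (1 ℕ.+ 4 ℕ.* j) ℕ.* (3 ℕ.* (0 ℕ.+ 4 ℕ.* j) ℕ.+ 2)
                ≡ 2 ℕ.+ 4 ℕ.* (0 ℕ.+ 5 ℕ.* j ℕ.+ 12 ℕ.* (j ℕ.* j))
    arith = ℕ.solve-∀

  p₁⁺ : even (q^ p⁺ (1 ℕ.+ n)) ≈ q^ quadratic 1 7 12 j
  p₁⁺ = even-q^-half-even (p⁺ (1 ℕ.+ n)) (quadratic 1 7 12 j) (p⁺-at 1) (arith j)
    where
    arith : ∀ j → (1 ℕ.+ 4 ℕ.* j) ℕ.* (3 ℕ.* (1 ℕ.+ 4 ℕ.* j) ℕ.+ 1)
                ≡ 4 ℕ.* (1 ℕ.+ 7 ℕ.* j ℕ.+ 12 ℕ.* (j ℕ.* j))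
    arith = ℕ.solve-∀

  p₂⁻ : even (q^ p⁻ (2 ℕ.+ n)) ≈ 0ˢ
  p₂⁻ = even-q^-half-odd (p⁻ (2 ℕ.+ n)) (quadratic 2 11 12 j) (p⁻-at 1) (arith j)
    where
    arith : ∀ j → (2 ℕ.+ 4 ℕ.* j) ℕ.* (3 ℕ.* (1 ℕ.+ 4 ℕ.* j) ℕ.+ 2)
                ≡ 2 ℕ.+ 4 ℕ.* (2 ℕ.+ 11 ℕ.* j ℕ.+ 12 ℕ.* (j ℕ.* j))
    arith = ℕ.solve-∀

  p₂⁺ : even (q^ p⁺ (2 ℕ.+ n)) ≈ 0ˢ
  p₂⁺ = even-q^-half-odd (p⁺ (2 ℕ.+ n)) (quadratic 3 13 12 j) (p⁺-at 2) (arith j)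
    where
    arith : ∀ j → (2 ℕ.+ 4 ℕ.* j) ℕ.* (3 ℕ.* (2 ℕ.+ 4 ℕ.* j) ℕ.+ 1)
                ≡ 2 ℕ.+ 4 ℕ.* (3 ℕ.+ 13 ℕ.* j ℕ.+ 12 ℕ.* (j ℕ.* j))
    arith = ℕ.solve-∀

  p₃⁻ : even (q^ p⁻ (3 ℕ.+ n)) ≈ q^ quadratic 6 17 12 j
  p₃⁻ = even-q^-half-even (p⁻ (3 ℕ.+ n)) (quadratic 6 17 12 j) (p⁻-at 2) (arith j)
    where
    arith : ∀ j → (3 ℕ.+ 4 ℕ.* j) ℕ.* (3 ℕ.* (2 ℕ.+ 4 ℕ.* j) ℕ.+ 2)
                ≡ 4 ℕ.* (6 ℕ.+ 17 ℕ.* j ℕ.+ 12 ℕ.* (j ℕ.* j))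
    arith = ℕ.solve-∀

  p₃⁺ : even (q^ p⁺ (3 ℕ.+ n)) ≈ 0ˢ
  p₃⁺ = even-q^-half-odd (p⁺ (3 ℕ.+ n)) (quadratic 7 19 12 j) (p⁺-at 3) (arith j)
    where
    arith : ∀ j → (3 ℕ.+ 4 ℕ.* j) ℕ.* (3 ℕ.* (3 ℕ.+ 4 ℕ.* j) ℕ.+ 1)
                ≡ 2 ℕ.+ 4 ℕ.* (7 ℕ.+ 19 ℕ.* j ℕ.+ 12 ℕ.* (j ℕ.* j))
    arith = ℕ.solve-∀

  p₄⁻ : even (q^ p⁻ (4 ℕ.+ n)) ≈ q^ quadratic 11 23 12 j
  p₄⁻ = even-q^-half-even (p⁻ (4 ℕ.+ n)) (quadratic 11 23 12 j) (p⁻-at 3) (arith j)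
    where
    arith : ∀ j → (4 ℕ.+ 4 ℕ.* j) ℕ.* (3 ℕ.* (3 ℕ.+ 4 ℕ.* j) ℕ.+ 2)
                ≡ 4 ℕ.* (11 ℕ.+ 23 ℕ.* j ℕ.+ 12 ℕ.* (j ℕ.* j))
    arith = ℕ.solve-∀

  p₄⁺ : even (q^ p⁺ (4 ℕ.+ n)) ≈ q^ quadratic 13 25 12 j
  p₄⁺ = even-q^-half-even (p⁺ (4 ℕ.+ n)) (quadratic 13 25 12 j) (p⁺-at 4) (arith j)
    where
    arith : ∀ j → (4 ℕ.+ 4 ℕ.* j) ℕ.* (3 ℕ.* (4 ℕ.+ 4 ℕ.* j) ℕ.+ 1)
                ≡ 4 ℕ.* (13 ℕ.+ 25 ℕ.* j ℕ.+ 12 ℕ.* (j ℕ.* j))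
    arith = ℕ.solve-∀

  -- k(3k+1)/2 is even for k = 4κ, where it is 2(12κ² + κ), and for k = 4κ + 1, where it is 2(12κ² +
  -- 7κ + 1). In this block k = ±(4j + 4) is 4κ with κ = ±(j + 1), while k = 4j + 1 and k = -(4j +
  -- 3) are 4κ + 1 with κ = j and κ = -(j + 1).
  even-block : ∀ N → even (Truncated.pentagonalBlock N n) ≈
    (q^ e₁ -[1+ j ] +ˢ q^ e₁ (+ suc j)) -ˢ q^ e₂ (+ j) -ˢ q^ e₂ -[1+ j ]
  even-block N i = trans
    (cong₂ _-_
      (cong₂ _-_
        (cong₂ _+_ (cong₂ _+_ (p₂⁻ i) (p₂⁺ i))
                   (cong₂ _+_ (rewrite-exponent (p₄⁻ i) (e₁-neg j)) (rewrite-exponent (p₄⁺ i) (e₁-pos j))))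
        (cong₂ _+_ (p₁⁻ i) (rewrite-exponent (p₁⁺ i) (e₂-pos j))))
      (cong₂ _+_ (rewrite-exponent (p₃⁻ i) (e₂-neg j)) (p₃⁺ i)))
    (lemma ((q^ e₁ -[1+ j ]) i) ((q^ e₁ (+ suc j)) i) ((q^ e₂ (+ j)) i) ((q^ e₂ -[1+ j ]) i))
    where
    rewrite-exponent : ∀ {x a b} → x ≡ (q^ b) i → a ≡ b → x ≡ (q^ a) i
    rewrite-exponent x≡ refl = x≡
    lemma : ∀ a b c d → 0ℤ + 0ℤ + (a + b) - (0ℤ + c) - (d + 0ℤ) ≡ a + b - c - d
    lemma = solve-∀

-- The identity modulo a power of q.

interval-∑ : ℕ → PowerSeries
interval-∑ m = ∑< (suc m) (λ n → rhs (+ n)) +ˢ ∑< m (λ n → rhs -[1+ n ])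

-- The range |k| ≤ 4r contains 4κ for |κ| ≤ r, but 4κ + 1 only for -r ≤ κ < r. The term of κ = r,
-- which `interval-∑ r` subtracts, is therefore added back.
even-pentagonal : ∀ N r →
  even (1ˢ +ˢ ∑< r (λ j → Truncated.pentagonalBlock N (double (double j)))) ≈
  interval-∑ r +ˢ q^ e₂ (+ r)
even-pentagonal N zero    i = trans (even-1 i) (lemma (1ˢ i) ((q^ 1) i))
  where
  even-1 : ∀ i → 1ˢ (double i) + 0ℤ ≡ 1ˢ i
  even-1 i = trans (ℤ.+-identityʳ _) (even-q^-double 0 i)
  lemma : ∀ x y → x ≡ 0ℤ + (x - y) + 0ℤ + y
  lemma = solve-∀
even-pentagonal N (suc r) i = begin
  1ˢ (double i) + (Σ + block)    ≡⟨ sym (ℤ.+-assoc (1ˢ (double i)) Σ block) ⟩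
  1ˢ (double i) + Σ + block      ≡⟨ cong₂ _+_ (even-pentagonal N r i) (PentagonalExponents.even-block r N i) ⟩
  -- The block cancels the correction c of stage r; g is subtracted within `rhs (+ suc r)` and added
  -- as the correction of stage r + 1.
  a + b + c + (d + e - c - f)    ≡⟨ lemma a b c d e f ((q^ e₂ (+ suc r)) i) ⟩
  a + (e - g) + (b + (d - f)) + g ∎
  where
  open ≡-Reasoning
  Σ = ∑< r (λ j → Truncated.pentagonalBlock N (double (double j))) (double i)
  block = Truncated.pentagonalBlock N (double (double r)) (double i)
  a = ∑< (suc r) (λ n → rhs (+ n)) i
  b = ∑< r (λ n → rhs -[1+ n ]) i
  c = (q^ e₂ (+ r)) i
  d = (q^ e₁ -[1+ r ]) i
  e = (q^ e₁ (+ suc r)) i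
  f = (q^ e₂ -[1+ r ]) i
  g = (q^ e₂ (+ suc r)) i
  lemma : ∀ a b c d e f g → a + b + c + (d + e - c - f) ≡ a + (e - g) + (b + (d - f)) + g
  lemma = solve-∀

finite-identity : ∀ L →
  qPoch (double L) *ˢ ∑< (suc L) lhs ≡[ suc L ] interval-∑ L +ˢ q^ e₂ (+ L)
finite-identity L = coefficients λ i i≤L → begin
  (qPoch K *ˢ ∑< (suc L) lhs) i
    ≡⟨ *ˢ-cong {A = qPoch K} (λ _ → refl) (λ j → sym (even-parity (suc L) j)) i ⟩
  (qPoch K *ˢ even Σ) i                    ≡⟨ sym (even-dilate-* (qPoch K) Σ i) ⟩
  even (dilate (qPoch K) *ˢ Σ) i           ≡⟨ coefficient (even-cong L product) i i≤L ⟩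
  even (1ˢ +ˢ blocks) i                    ≡⟨ even-pentagonal N L i ⟩
  (interval-∑ L +ˢ q^ e₂ (+ L)) i          ∎
  where
  open ≡-Reasoning
  -- K = 2L makes the pentagonal sum for (t;t)_{2K} end at 4L, after L whole blocks. N = 2L + 1 is
  -- the precision that `even-cong` asks for, and M = N in `euler-identity` gives the 2(L + 1) terms
  -- of `euler-parity`.
  K = double L
  N = suc (double L)
  open Truncated N hiding (∑<)
  J : ℕ → PowerSeries
  J m = dilate (1/ˢ qPoch m)
  open Euler J
    (≈⇒≋ λ i → trans (dilate-cong 1/qPoch-zero i) (dilate-q^ 0 i))
    (λ m → ≈⇒≋ λ i → trans (dilate-cong (1/qPoch-suc m) i) (dilate-1-q^-* (suc m) (1/ˢ qPoch (suc m)) i))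
  Σ blocks : PowerSeries
  Σ = ∑< (suc L) (λ j → J (double j) *ˢ q^ double (2 ℕ.* j ℕ.^ 2)
        +ˢ J (suc (double j)) *ˢ -ˢ q^ suc (double (2 ℕ.* (j ℕ.* suc j))))
  blocks = ∑< L (λ j → pentagonalBlock (double (double j)))

  N≤1+2K : N ≤ suc (double K)
  N≤1+2K = s≤s (ℕ.≤-trans (ℕ.m≤m+n K K) (ℕ.≤-reflexive (sym (double≡+ K))))

  product : dilate (qPoch K) *ˢ Σ ≋ 1ˢ +ˢ blocks
  product = ≋-trans
    (*ˢ-cong-≋ {A = dilate (qPoch K)} ≋-refl (≋-trans (≋-sym (euler-parity (suc L)))
      (euler-identity K N N≤1+2K (ℕ.m≤m*n N N))))
    (≋-trans (Q⊗oddPochhammer qPoch (dilate ∘ qPoch) ≋-refl (λ _ → ≋-refl)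
        (≈⇒≋ (dilate-q^ 0)) (λ n → ≈⇒≋ (dilate-qPoch-suc n)) K)
    (≋-trans (pentagonal-number-theorem (double K) N≤1+2K)
      (pentagonal-blocks L)))

-- Passage to the infinite sums and product.

∑<-truncate : ∀ f {i m n} → m ≤ n → (∀ j → m ≤ j → f j i ≡ 0ℤ) → ∑< m f i ≡ ∑< n f i
∑<-truncate f {i} {m} {n} m≤n v =
  trans (sym (∑<-stable f i m (n ℕ.∸ m) v)) (cong (λ k → ∑< k f i) (ℕ.m∸n+n≡m m≤n))

-- `lhs-summable` sums coefficient i over `upTo (suc i)`; the later summands do not reach q^i.
∑ˢ-lhs : ∀ n → ∑ˢ lhs lhs-summable ≡[ suc n ] ∑< (suc n) lhs
∑ˢ-lhs n = coefficients λ i i<1+n → trans (foldr-upTo lhs i (suc i))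
  (∑<-truncate lhs i<1+n λ j i<j →
    proj₂ (proj₂ (lhs-summable i)) j λ j∈ → ℕ.<⇒≱ (∈-upTo⁻ j∈) i<j)

rhs-vanishes : ∀ k i → i < ∣ k ∣ → rhs k i ≡ 0ℤ
rhs-vanishes k i i<∣k∣ = cong₂ _-_
  (q^-below (e₁ k) i (ℕ.<-≤-trans i<∣k∣ (∣∣-mono (∣k∣≤12k²+k k))))
  (q^-below (e₂ k) i (ℕ.<-≤-trans i<∣k∣ (∣∣-mono (∣k∣≤12k²+7k+1 k))))
  where
  ∣∣-mono : ∀ {m e} → + m ℤ.≤ e → m ≤ ∣ e ∣
  ∣∣-mono (ℤ.+≤+ m≤e) = m≤e

-- The correction from `finite-identity` is q^{12n²+7n+1}, which vanishes modulo q^{n+1}.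
∑ˢ-rhs : ∀ n → ∑ˢ rhs rhs-summable ≡[ suc n ] interval-∑ n +ˢ q^ e₂ (+ n)
∑ˢ-rhs n = coefficients λ i i<1+n → begin
  foldr _+_ 0ℤ (map (g i) (map +_ (upTo (suc i)) ++ map -[1+_] (upTo i)))
    ≡⟨ cong (foldr _+_ 0ℤ) (List.map-++ (g i) (map +_ (upTo (suc i))) (map -[1+_] (upTo i))) ⟩
  foldr _+_ 0ℤ (map (g i) (map +_ (upTo (suc i))) ++ map (g i) (map -[1+_] (upTo i)))
    ≡⟨ foldr-++ (map (g i) (map +_ (upTo (suc i)))) (map (g i) (map -[1+_] (upTo i))) ⟩
  foldr _+_ 0ℤ (map (g i) (map +_ (upTo (suc i)))) + foldr _+_ 0ℤ (map (g i) (map -[1+_] (upTo i)))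
    ≡⟨ cong₂ (λ xs ys → foldr _+_ 0ℤ xs + foldr _+_ 0ℤ ys)
         (sym (List.map-∘ {g = g i} {f = +_} (upTo (suc i))))
         (sym (List.map-∘ {g = g i} {f = -[1+_]} (upTo i))) ⟩
  foldr _+_ 0ℤ (map (g i ∘ +_) (upTo (suc i))) + foldr _+_ 0ℤ (map (g i ∘ -[1+_]) (upTo i))
    ≡⟨ cong₂ _+_ (foldr-upTo rhs⁺ i (suc i)) (foldr-upTo rhs⁻ i i) ⟩
  ∑< (suc i) rhs⁺ i + ∑< i rhs⁻ i
    ≡⟨ cong₂ _+_ (∑<-truncate rhs⁺ i<1+n λ j → rhs-vanishes (+ j) i)
         -- `-[1+ j ]` has absolute value j + 1, so i negative indices go with i + 1 nonnegative
         -- ones.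
         (∑<-truncate rhs⁻ (ℕ.≤-pred i<1+n) λ j i≤j → rhs-vanishes -[1+ j ] i (s≤s i≤j)) ⟩
  interval-∑ n i
    ≡⟨ sym (ℤ.+-identityʳ (interval-∑ n i)) ⟩
  interval-∑ n i + 0ℤ
    ≡⟨ cong (λ x → interval-∑ n i + x) (sym (q^-below (e₂ (+ n)) i
         (ℕ.<-≤-trans i<1+n (ℕ.≤-trans n<e₂ (ℕ.≤-reflexive (sym (e₂-pos n))))))) ⟩
  (interval-∑ n +ˢ q^ e₂ (+ n)) i ∎
  where
  open ≡-Reasoning
  g : ℕ → ℤ → ℤ
  g i k = rhs k i
  rhs⁺ rhs⁻ : ℕ → PowerSeries
  rhs⁺ = rhs ∘ +_
  rhs⁻ = rhs ∘ -[1+_]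
  n<e₂ : n < quadratic 1 7 12 n
  n<e₂ = s≤s (ℕ.≤-trans (ℕ.m≤m+n n (6 ℕ.* n)) (ℕ.m≤m+n (7 ℕ.* n) (12 ℕ.* (n ℕ.* n))))

qPoch∞-truncate : ∀ n → qPoch∞ ≡[ suc n ] qPoch (double n)
qPoch∞-truncate n = coefficients λ i i<1+n → sym (proj₂ (qPoch-convergent i) (double n)
  (ℕ.≤-trans (ℕ.≤-pred i<1+n) (ℕ.≤-trans (ℕ.m≤m+n n n) (ℕ.≤-reflexive (sym (double≡+ n))))))

corollary5p5 : ∑ˢ (λ n → q^ (2 ℕ.* n ℕ.^ 2) /ˢ qPoch (2 ℕ.* n)) lhs-summable
    ≈
    (1/ˢ qPoch∞) *ˢ
    ∑ˢ (λ k → q^ ∣ + 12 * k ^ 2 + k ∣ -ˢ q^ ∣ + 12 * k ^ 2 + + 7 * k + + 1 ∣)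
    rhs-summable
corollary5p5 n = coefficient
  -- Coefficient n is read off modulo q^{n+1}, where (q;q)_∞ agrees with (q;q)_{2n} and
  -- `finite-identity` applies with L = n.
  (divide {a = qPoch∞} {b = 1/ˢ qPoch∞} {c = ∑ˢ lhs lhs-summable} {d = ∑ˢ rhs rhs-summable}
    (≈⇒≋ (*ˢ-inverseʳ qPoch∞ qPoch∞-constant))
    (≋-trans (*ˢ-cong-≋ {A = qPoch∞} {B = ∑ˢ lhs lhs-summable} (qPoch∞-truncate n) (∑ˢ-lhs n))
    (≋-trans (finite-identity n) (≋-sym (∑ˢ-rhs n)))))
  n (ℕ.n<1+n n)
  where open Truncated (suc n)
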